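{- Let $T$ be a finite tree with $E(T)\neq\varnothing$. Then: (a) The map $F_T$ has a unique fixed point $w_T^\star\in[1,\infty)^{E(T)}$. (b) $\mathrm{DN}_{\mathrm{LLY}}(T)=\max_{e\in E(T)}w_T^\star(e)$. (c) The fixed point $w_T^\star$ is coordinatewise minimal among normalized admissible weights (i.e. it is a normalized admissible weight and $w_T^\star\le z$ coordinatewise for every normalized admissible weight $z$), and it is the unique normalized optimal weight. Equivalently, all optimal weights of $T$ differ only by a global positive scalar. (d) Every pendant edge $e$ satisfies $w_T^\star(e)=1$, while every non-pendant edge has zero Lin--Lu--Yau curvature under $w_T^\star$.
   Context: Graphs are simple and undirected. Let $d(\cdot,\cdot)$ be the combinatorial graph distance. For a positive edge weight $w:E\to(0,\infty)$ put $d_x^w:=\sum_{y\sim x}w_{xy}$. For $\alpha\in[0,1]$ let $\mu_x^{\alpha,w}$ be the probability measure with $\mu_x^{\alpha,w}(x)=\alpha$, $\mu_x^{\alpha,w}(z)=(1-\alpha)w_{xz}/d_x^w$ for $z\sim x$, and $0$ otherwise. Let $W_1$ be the $1$-Wasserstein distance with respect to $d$. For $x\sim y$ let $\kappa_\alpha^w(x,y):=1-W_1(\mu_x^{\alpha,w},\mu_y^{\alpha,w})$ and define the weighted Lin--Lu--Yau curvature $\kappa_{\mathrm{LLY}}^w(x,y):=\lim_{\alpha\to1^- }\kappa_\alpha^w(x,y)/(1-\alpha)$. For connected locally finite $G$ with $E\neq\varnothing$: $\mathrm{Dist}(w):=\sup_{e\in E}w_e/\inf_{e\in E}w_e$, with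 value $+\infty$ if the supremum is infinite or the infimum is $0$; a positive weight $w$ is admissible if $\kappa_{\mathrm{LLY}}^w(e)\ge0$ for every $e\in E$; and $\mathrm{DN}_{\mathrm{LLY}}(G):=\inf\{\mathrm{Dist}(w): w \text{ admissible}\}$, with value $+\infty$ if no admissible weight has finite distortion. An admissible weight $w$ is optimal if $\mathrm{Dist}(w)=\mathrm{DN}_{\mathrm{LLY}}(G)$. A finite-distortion weight is normalized if $\inf_{e}w_e=1$. An edge of a tree is pendant if it is incident with a leaf (vertex of degree $1$), and non-pendant otherwise. For a tree $T$, $x\in[1,\infty)^{E(T)}$ and an edge $uv$, put $A_{u\mid v}(x):=\sum_{f\ni u,\ f\ne uv}x_f$ (sum over edges $f$ of $T$ incident with $u$ other than $uv$). The map $F_T:[1,\infty)^{E(T)}\to[1,\infty)^{E(T)}$ is defined by $$(F_T(x))_{uv}:=\max\Bigl\{1,\sqrt{A_{u\mid v}(x)\,A_{v\mid u}(x)}\Bigr\},\qquad uv\in E(T).$$ -}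

module Defs where

open import Level using (0ℓ)
open import Algebra.Bundles using (CommutativeRing)
open import Data.Bool.Base using (if_then_else_)
open import Data.Empty using (⊥-elim)
open import Data.Fin.Base using (Fin)
open import Data.Fin.Properties using (any?) renaming (_≟_ to _≟ᶠ_)
open import Data.List.Base using (List; []; _∷_; length; filter; allFin)
open import Data.List.Relation.Unary.Unique.Propositional using (Unique)
open import Data.Nat.Base as ℕ using (ℕ; zero; suc)
open import Data.Product.Base using (∃; ∃₂; _×_; _,_; proj₁; proj₂)
open import Data.Sum.Base using (_⊎_; inj₁; inj₂)
open import Function.Base using (_∘_)
open import Relation.Binary.Bundles using (TotalOrder)
open import Relation.Binary.Core using (Rel)
open import Relation.Binary.Definitions using () renaming (Decidable to Decidable₂)
open import Relation.Binary.PropositionalEquality.Core as ≡ using (_≡_)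
open import Relation.Binary.Structures using (IsDecTotalOrder)
open import Relation.Nullary using (¬_; Dec; yes; no; does)
open import Relation.Nullary.Decidable using (¬?; _×-dec_; map′)
open import Relation.Nullary.Construct.Add.Supremum using (_⁺; [_]; ⊤⁺)
open import Relation.Unary using (Pred; Decidable; Satisfiable)
import Algebra.Construct.NaturalChoice.Max as Max
import Algebra.Properties.Semiring.Mult as Mult
import Algebra.Properties.Semiring.Sum as Sum
import Algebra.Solver.Ring.NaturalCoefficients.Default as Solver
import Relation.Binary.Construct.Add.Supremum.NonStrict as AddSupremum
import Relation.Binary.Construct.NonStrictToStrict as Strict

------------------------------------------------------------------------
-- Suprema and infima

module _ {A : Set} (_≤_ : Rel A 0ℓ) where

  UpperBound LowerBound IsSupremum IsInfimum IsMaximum : Pred A 0ℓ → Pred A 0ℓ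
  UpperBound P b = ∀ a → P a → a ≤ b
  LowerBound P b = ∀ a → P a → b ≤ a
  IsSupremum P s = UpperBound P s × (∀ b → UpperBound P b → s ≤ b)
  IsInfimum  P i = LowerBound P i × (∀ b → LowerBound P b → b ≤ i)
  IsMaximum  P m = P m × UpperBound P m

------------------------------------------------------------------------
-- The real numbers
--
-- There is no type of real numbers in the standard library, so ℝ is an
-- arbitrary Dedekind-complete ordered field; classically this determines
-- it up to unique isomorphism.  The order is decidable because the
-- mathematics is classical.

record CompleteOrderedField : Set₁ where
  field
    commutativeRing : CommutativeRing 0ℓ 0ℓ

  open CommutativeRing commutativeRing public

  infix 4 _≤_
  infix 8 _⁻¹
  infixl 7 _/_

  field
    _≤_             : Rel Carrier 0ℓ
    isDecTotalOrder : IsDecTotalOrder _≈_ _≤_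
    0≉1             : ¬ 0# ≈ 1#
    inverse         : ∀ x → ¬ x ≈ 0# → ∃ λ y → x * y ≈ 1#
    +-monoʳ-≤       : ∀ x {y z} → y ≤ z → x + y ≤ x + z
    *-nonNeg        : ∀ {x y} → 0# ≤ x → 0# ≤ y → 0# ≤ x * y
    supremum        : ∀ (P : Pred Carrier 0ℓ) → Satisfiable P →
                      ∃ (UpperBound _≤_ P) → ∃ (IsSupremum _≤_ P)

  open IsDecTotalOrder isDecTotalOrder public
    using (_≟_; _≤?_; total; antisym; isTotalOrder)
    renaming ( refl to ≤-refl; reflexive to ≤-reflexive; trans to ≤-trans
             ; ≤-respˡ-≈ to ≤-respˡ; ≤-respʳ-≈ to ≤-respʳ)

  totalOrder : TotalOrder 0ℓ 0ℓ 0ℓ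
  totalOrder = record { isTotalOrder = isTotalOrder }

  open Strict _≈_ _≤_ public using (_<_)
  open Max totalOrder public using (_⊔_)
  open Sum semiring public using (sum; sum-syntax)
  open Mult semiring public using () renaming (_×_ to _·_)

  -- Division is total, with x / y ≈ 0# for y ≈ 0#.
  _⁻¹ : Carrier → Carrier
  x ⁻¹ with x ≟ 0#
  ... | yes _  = 0#
  ... | no x≉0 = proj₁ (inverse x x≉0)

  _/_ : Carrier → Carrier → Carrier
  x / y = x * y ⁻¹

  ∣_∣ : Carrier → Carrier
  ∣ x ∣ = x ⊔ - x

------------------------------------------------------------------------
-- Square roots, and the facts about the order they rest on

module SquareRoot (ℝ : CompleteOrderedField) where
  open CompleteOrderedField ℝ
  open Solver commutativeSemiring using (solve; _:=_; _:+_; _:*_; con)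

  difference : ∀ {x y} → x ≤ y → ∃ λ d → 0# ≤ d × x + d ≈ y
  difference {x} {y} x≤y =
    y - x ,
    ≤-respˡ (-‿inverseˡ x) (≤-respʳ (+-comm _ _) (+-monoʳ-≤ (- x) x≤y)) ,
    trans (+-congˡ (+-comm _ _))
      (trans (sym (+-assoc _ _ _))
        (trans (+-congʳ (-‿inverseʳ x)) (+-identityˡ y)))

  x≤x+y : ∀ {x y} → 0# ≤ y → x ≤ x + y
  x≤x+y {x} 0≤y = ≤-respˡ (+-identityʳ x) (+-monoʳ-≤ x 0≤y)

  +-nonNeg : ∀ {x y} → 0# ≤ x → 0# ≤ y → 0# ≤ x + y
  +-nonNeg 0≤x 0≤y = ≤-trans 0≤x (x≤x+y 0≤y)

  +-cancelˡ-≤ : ∀ x {y z} → x + y ≤ x + z → y ≤ z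
  +-cancelˡ-≤ x {y} {z} p = ≤-respˡ (cancel y) (≤-respʳ (cancel z) (+-monoʳ-≤ (- x) p))
    where
    cancel : ∀ u → - x + (x + u) ≈ u
    cancel u = trans (sym (+-assoc _ _ _))
                 (trans (+-congʳ (-‿inverseˡ x)) (+-identityˡ u))

  x+y≤x⇒y≤0 : ∀ {x y} → x + y ≤ x → y ≤ 0#
  x+y≤x⇒y≤0 {x} p = +-cancelˡ-≤ x (≤-respʳ (sym (+-identityʳ x)) p)

  *-monoʳ-≤ : ∀ {x y z} → 0# ≤ x → y ≤ z → x * y ≤ x * z
  *-monoʳ-≤ {x} 0≤x y≤z with difference y≤z
  ... | d , 0≤d , y+d≈z =
    ≤-respʳ (trans (sym (distribˡ x _ d)) (*-congˡ y+d≈z)) (x≤x+y (*-nonNeg 0≤x 0≤d))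

  square-mono-≤ : ∀ {x y} → 0# ≤ x → x ≤ y → x * x ≤ y * y
  square-mono-≤ 0≤x x≤y =
    ≤-trans (*-monoʳ-≤ 0≤x x≤y)
      (≤-respˡ (*-comm _ _) (*-monoʳ-≤ (≤-trans 0≤x x≤y) x≤y))

  0≤1 : 0# ≤ 1#
  0≤1 with total 0# 1#
  ... | inj₁ p = p
  ... | inj₂ 1≤0 with difference 1≤0
  ... | d , 0≤d , 1+d≈0 = ≤-respʳ dd≈1 (*-nonNeg 0≤d 0≤d)
    where
    d+dd≈0 : d + d * d ≈ 0#
    d+dd≈0 = trans (+-congʳ (sym (*-identityʳ d))) (trans (sym (distribˡ d 1# d))
               (trans (*-congˡ 1+d≈0) (zeroʳ d)))
    dd≈1 : d * d ≈ 1#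
    dd≈1 = trans (sym (+-identityˡ _)) (trans (+-congʳ (sym 1+d≈0))
             (trans (+-assoc _ _ _) (trans (+-congˡ d+dd≈0) (+-identityʳ 1#))))

  square≈0⇒≈0 : ∀ {x} → x * x ≈ 0# → x ≈ 0#
  square≈0⇒≈0 {x} xx≈0 with x ≟ 0#
  ... | yes x≈0 = x≈0
  ... | no x≉0 with inverse x x≉0
  ... | y , xy≈1 = trans (sym (*-identityʳ x)) (trans (*-congˡ (sym xy≈1))
                     (trans (sym (*-assoc _ _ _)) (trans (*-congʳ xx≈0) (zeroˡ y))))

  private
    square-injective-≤ : ∀ {x y} → 0# ≤ x → x * x ≈ y * y → x ≤ y → x ≈ y
    square-injective-≤ {x} {y} 0≤x xx≈yy x≤y with difference x≤y
    ... | d , 0≤d , x+d≈y =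
      trans (sym (+-identityʳ x)) (trans (+-congˡ (sym (square≈0⇒≈0 dd≈0))) x+d≈y)
      where
      expand : x * x + (d * d + (x * d + x * d)) ≈ x * x
      expand = trans (solve 2 (λ x d → x :* x :+ (d :* d :+ (x :* d :+ x :* d))
                                     := (x :+ d) :* (x :+ d)) refl x d)
                 (trans (*-cong x+d≈y x+d≈y) (sym xx≈yy))
      0≤xd : 0# ≤ x * d
      0≤xd = *-nonNeg 0≤x 0≤d
      dd≈0 : d * d ≈ 0#
      dd≈0 = antisym (≤-trans (x≤x+y (+-nonNeg 0≤xd 0≤xd))
                              (x+y≤x⇒y≤0 (≤-reflexive expand)))
                     (*-nonNeg 0≤d 0≤d)

  square-injective : ∀ {x y} → 0# ≤ x → 0# ≤ y → x * x ≈ y * y → x ≈ y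
  square-injective {x} {y} 0≤x 0≤y xx≈yy with total x y
  ... | inj₁ x≤y = square-injective-≤ 0≤x xx≈yy x≤y
  ... | inj₂ y≤x = sym (square-injective-≤ 0≤y (sym xx≈yy) y≤x)

  -- For 0 ≤ d and K ≉ 0 this is the nonnegative quotient d / K.
  private
    quotient : ∀ {d K} → 0# ≤ d → ¬ d ≈ 0# → 0# ≤ K → ¬ K ≈ 0# →
               ∃ λ h → 0# ≤ h × K * h ≈ d
    quotient {d} {K} 0≤d d≉0 0≤K K≉0 with inverse K K≉0
    ... | k , Kk≈1 = k * d , 0≤h , Kh≈d
      where
      Kh≈d : K * (k * d) ≈ d
      Kh≈d = trans (sym (*-assoc _ _ _)) (trans (*-congʳ Kk≈1) (*-identityˡ d))
      0≤h : 0# ≤ k * d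
      0≤h with total 0# (k * d)
      ... | inj₁ p = p
      ... | inj₂ p = ⊥-elim (d≉0 (antisym
                       (≤-respˡ Kh≈d (≤-respʳ (zeroʳ K) (*-monoʳ-≤ 0≤K p))) 0≤d))

  abstract
    sqrt-exists : ∀ {a} → 0# ≤ a → ∃ λ s → 0# ≤ s × s * s ≈ a
    sqrt-exists {a} 0≤a = s , 0≤s , ss≈a
      where
      S : Pred Carrier 0ℓ
      S x = 0# ≤ x × x * x ≤ a

      bound : UpperBound _≤_ S (1# + a)
      bound x (0≤x , xx≤a) with total x 1#
      ... | inj₁ x≤1 = ≤-trans x≤1 (x≤x+y 0≤a)
      ... | inj₂ 1≤x = ≤-trans (≤-respˡ (*-identityʳ x) (*-monoʳ-≤ 0≤x 1≤x))
                         (≤-trans xx≤a (≤-respʳ (+-comm a 1#) (x≤x+y 0≤1)))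

      lub : ∃ (IsSupremum _≤_ S)
      lub = supremum S (0# , ≤-refl , ≤-respˡ (sym (zeroˡ 0#)) 0≤a) (1# + a , bound)

      s : Carrier
      s = proj₁ lub

      0≤s : 0# ≤ s
      0≤s = proj₁ (proj₂ lub) 0# (≤-refl , ≤-respˡ (sym (zeroˡ 0#)) 0≤a)

      too-small : ∀ {d} → 0# ≤ d → s * s + d ≈ a → d ≈ 0#
      too-small {d} 0≤d ss+d≈a with d ≟ 0#
      ... | yes d≈0 = d≈0
      ... | no d≉0 with quotient {K = 1# + (s + s + d)} 0≤d d≉0
                          (+-nonNeg 0≤1 0≤K′)
                          (λ K≈0 → 0≉1 (antisym 0≤1 (≤-respʳ K≈0 (x≤x+y 0≤K′))))
        where
        0≤K′ : 0# ≤ s + s + d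
        0≤K′ = +-nonNeg (+-nonNeg 0≤s 0≤s) 0≤d
      ... | h , 0≤h , Kh≈d = ⊥-elim (d≉0 (trans (sym Kh≈d) (trans (*-congˡ h≈0) (zeroʳ _))))
        where
        split : ∀ u → (1# + u) * h ≈ h + u * h
        split u = trans (distribʳ h 1# u) (+-congʳ (*-identityˡ h))
        0≤2sh : 0# ≤ s * h + s * h
        0≤2sh = +-nonNeg (*-nonNeg 0≤s 0≤h) (*-nonNeg 0≤s 0≤h)
        h≤d : h ≤ d
        h≤d = ≤-respʳ (trans (sym (split _)) Kh≈d)
                (x≤x+y (*-nonNeg (+-nonNeg (+-nonNeg 0≤s 0≤s) 0≤d) 0≤h))
        hh≤h+dh : h * h ≤ h + d * h
        hh≤h+dh = ≤-trans (≤-respʳ (*-comm h d) (*-monoʳ-≤ 0≤h h≤d))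
                    (≤-respʳ (+-comm _ _) (x≤x+y 0≤h))
        square≤a : (s + h) * (s + h) ≤ a
        square≤a =
          ≤-respˡ (solve 2 (λ s h → (s :* s :+ (s :* h :+ s :* h)) :+ h :* h
                                  := (s :+ h) :* (s :+ h)) refl s h)
            (≤-respʳ
              (trans (solve 4 (λ ss h s d → (ss :+ (s :* h :+ s :* h)) :+ (h :+ d :* h)
                                     := ss :+ (h :+ (s :+ s :+ d) :* h)) refl (s * s) h s d)
                (trans (+-congˡ (trans (sym (split _)) Kh≈d)) ss+d≈a))
              (+-monoʳ-≤ _ hh≤h+dh))
        h≈0 : h ≈ 0#
        h≈0 = antisym (x+y≤x⇒y≤0 (proj₁ (proj₂ lub) (s + h) (+-nonNeg 0≤s 0≤h , square≤a))) 0≤h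

      too-large : ∀ {d} → 0# ≤ d → a + d ≈ s * s → d ≈ 0#
      too-large {d} 0≤d a+d≈ss with d ≟ 0#
      ... | yes d≈0 = d≈0
      ... | no d≉0 = ⊥-elim (d≉0 (trans (sym (proj₂ (proj₂ q))) (trans (*-congˡ h≈0) (zeroʳ _))))
        where
        d≤ss : d ≤ s * s
        d≤ss = ≤-respʳ (trans (+-comm d a) a+d≈ss) (x≤x+y 0≤a)
        2s≉0 : ¬ s + s ≈ 0#
        2s≉0 2s≈0 = d≉0 (antisym (≤-respʳ (trans (*-congʳ s≈0) (zeroˡ s)) d≤ss) 0≤d)
          where
          s≈0 : s ≈ 0#
          s≈0 = antisym (≤-respʳ 2s≈0 (x≤x+y 0≤s)) 0≤s
        q : ∃ λ h → 0# ≤ h × (s + s) * h ≈ d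
        q = quotient 0≤d d≉0 (+-nonNeg 0≤s 0≤s) 2s≉0
        h : Carrier
        h = proj₁ q
        0≤h : 0# ≤ h
        0≤h = proj₁ (proj₂ q)
        h≤s : h ≤ s
        h≤s with total h s
        ... | inj₁ p = p
        ... | inj₂ s≤h = ⊥-elim (d≉0 (antisym (≤-trans d≤ss ss≤0) 0≤d))
          where
          ss≤0 : s * s ≤ 0#
          ss≤0 = x+y≤x⇒y≤0 (≤-trans
                   (≤-respˡ (distribʳ s s s)
                     (≤-respʳ (proj₂ (proj₂ q)) (*-monoʳ-≤ (+-nonNeg 0≤s 0≤s) s≤h)))
                   d≤ss)
        gap : ∃ λ t → 0# ≤ t × h + t ≈ s
        gap = difference h≤s
        t : Carrier
        t = proj₁ gap
        0≤t : 0# ≤ t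
        0≤t = proj₁ (proj₂ gap)
        h+t≈s : h + t ≈ s
        h+t≈s = proj₂ (proj₂ gap)
        d≈ : d ≈ (h + t + (h + t)) * h
        d≈ = trans (sym (proj₂ (proj₂ q))) (*-congʳ (sym (+-cong h+t≈s h+t≈s)))
        X : Carrier
        X = h * h + (t * h + t * h)
        balance : X + (a + h * h) ≈ X + t * t
        balance =
          trans (solve 3 (λ h t a → (h :* h :+ (t :* h :+ t :* h)) :+ (a :+ h :* h)
                                  := a :+ (h :+ t :+ (h :+ t)) :* h) refl h t a)
            (trans (trans (+-congˡ (sym d≈)) (trans a+d≈ss (sym (*-cong h+t≈s h+t≈s))))
              (solve 2 (λ h t → (h :+ t) :* (h :+ t)
                              := (h :* h :+ (t :* h :+ t :* h)) :+ t :* t) refl h t))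
        a≤tt : a ≤ t * t
        a≤tt = ≤-trans (x≤x+y (*-nonNeg 0≤h 0≤h)) (+-cancelˡ-≤ X (≤-reflexive balance))
        t-bound : UpperBound _≤_ S t
        t-bound x (0≤x , xx≤a) with total x t
        ... | inj₁ p = p
        ... | inj₂ t≤x = ≤-reflexive (square-injective 0≤x 0≤t
                           (antisym (≤-trans xx≤a a≤tt) (square-mono-≤ 0≤t t≤x)))
        h≈0 : h ≈ 0#
        h≈0 = antisym (x+y≤x⇒y≤0 (≤-respˡ (trans (sym h+t≈s) (+-comm h t))
                                         (proj₂ (proj₂ lub) t t-bound))) 0≤h

      ss≈a : s * s ≈ a
      ss≈a with total (s * s) a
      ... | inj₁ ss≤a with difference ss≤a
      ... | d , 0≤d , e = trans (sym (+-identityʳ _)) (trans (+-congˡ (sym (too-small 0≤d e))) e)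
      ss≈a | inj₂ a≤ss with difference a≤ss
      ... | d , 0≤d , e = sym (trans (sym (+-identityʳ _)) (trans (+-congˡ (sym (too-large 0≤d e))) e))

  √ : ∀ {a} → 0# ≤ a → Carrier
  √ 0≤a = proj₁ (sqrt-exists 0≤a)

  √-nonNeg : ∀ {a} (0≤a : 0# ≤ a) → 0# ≤ √ 0≤a
  √-nonNeg 0≤a = proj₁ (proj₂ (sqrt-exists 0≤a))

  √-square : ∀ {a} (0≤a : 0# ≤ a) → √ 0≤a * √ 0≤a ≈ a
  √-square 0≤a = proj₂ (proj₂ (sqrt-exists 0≤a))

  √-cong : ∀ {a b} (0≤a : 0# ≤ a) (0≤b : 0# ≤ b) → a ≈ b → √ 0≤a ≈ √ 0≤b
  √-cong 0≤a 0≤b a≈b = square-injective (√-nonNeg 0≤a) (√-nonNeg 0≤b)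
    (trans (√-square 0≤a) (trans a≈b (sym (√-square 0≤b))))

  sum-nonNeg : ∀ {n} (f : Fin n → Carrier) → (∀ i → 0# ≤ f i) → 0# ≤ sum f
  sum-nonNeg {zero}  f 0≤f = ≤-refl
  sum-nonNeg {suc n} f 0≤f = +-nonNeg (0≤f Fin.zero) (sum-nonNeg (f ∘ Fin.suc) (0≤f ∘ Fin.suc))

------------------------------------------------------------------------
-- Finite simple graphs

record SimpleGraph (n : ℕ) : Set₁ where
  infix 4 _~_ _~?_
  field
    _~_   : Rel (Fin n) 0ℓ
    _~?_  : Decidable₂ _~_
    ~-sym : ∀ {x y} → x ~ y → y ~ x
    ~-irr : ∀ {x} → ¬ x ~ x

module _ {n} (G : SimpleGraph n) where
  open SimpleGraph G

  data Walk : Fin n → Fin n → ℕ → Set where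
    stop : ∀ {x} → Walk x x 0
    step : ∀ {x y z k} → x ~ y → Walk y z k → Walk x z (suc k)

  vertices : ∀ {x y k} → Walk x y k → List (Fin n)
  vertices {x} stop       = x ∷ []
  vertices {x} (step _ p) = x ∷ vertices p

  Connected : Set
  Connected = ∀ x y → ∃ (Walk x y)

  -- A cycle is a path with at least two edges whose endpoints are adjacent.
  Acyclic : Set
  Acyclic = ∀ {x y k} (p : Walk x y k) → 2 ℕ.≤ k → Unique (vertices p) → ¬ y ~ x

  HasEdge : Set
  HasEdge = ∃₂ λ x y → x ~ y

  degree : Fin n → ℕ
  degree x = length (filter (x ~?_) (allFin n))

  Pendant : Rel (Fin n) 0ℓ
  Pendant x y = degree x ≡ 1 ⊎ degree y ≡ 1

  walk? : ∀ x y k → Dec (Walk x y k)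
  walk? x y zero    = map′ (λ { ≡.refl → stop }) (λ { stop → ≡.refl }) (x ≟ᶠ y)
  walk? x y (suc k) = map′ (λ { (_ , e , p) → step e p }) (λ { (step e p) → _ , e , p })
                        (any? λ z → (x ~? z) ×-dec walk? z y k)

least : ∀ {P : ℕ → Set} → Decidable P → ∀ k → P k →
        ∃ λ m → P m × (∀ j → P j → m ℕ.≤ j)
least P? zero    p = zero , p , λ _ _ → ℕ.z≤n
least P? (suc k) p with P? zero
... | yes p₀ = zero , p₀ , λ _ _ → ℕ.z≤n
... | no ¬p₀ with least (P? ∘ suc) k p
... | m , pm , m≤ = suc m , pm , λ { zero p₀ → ⊥-elim (¬p₀ p₀) ; (suc j) pj → ℕ.s≤s (m≤ j pj) }

dist : ∀ {n} (G : SimpleGraph n) → Connected G → Fin n → Fin n → ℕ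
dist G connected x y =
  proj₁ (least (walk? G x y) (proj₁ (connected x y)) (proj₂ (connected x y)))

record IsTree {n} (G : SimpleGraph n) : Set where
  field
    connected : Connected G
    acyclic   : Acyclic G

------------------------------------------------------------------------
-- Edge functions
--
-- A function on undirected edges is a function of two endpoints which is
-- symmetric on adjacent pairs; its values elsewhere are never used, and
-- equality of edge functions is equality on edges.

module EdgeFunctions (ℝ : CompleteOrderedField) {n} (G : SimpleGraph n) where
  open CompleteOrderedField ℝ
  open SquareRoot ℝ
  open SimpleGraph G

  infix 4 _≈ᴱ_ _≤ᴱ_

  _≈ᴱ_ _≤ᴱ_ : Rel (Fin n → Fin n → Carrier) 0ℓ
  v ≈ᴱ w = ∀ {x y} → x ~ y → v x y ≈ w x y
  v ≤ᴱ w = ∀ {x y} → x ~ y → v x y ≤ w x y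

  EdgeValue : (Fin n → Fin n → Carrier) → Pred Carrier 0ℓ
  EdgeValue w r = ∃₂ λ x y → x ~ y × r ≈ w x y

  record Weight : Set where
    field
      ⟦_⟧       : Fin n → Fin n → Carrier
      symmetric : ∀ {x y} → x ~ y → ⟦_⟧ x y ≈ ⟦_⟧ y x
      positive  : ∀ {x y} → x ~ y → 0# < ⟦_⟧ x y

  open Weight public using (⟦_⟧)

  -- [1,∞)ᴱ
  record Box : Set where
    field
      value     : Fin n → Fin n → Carrier
      symmetric : ∀ {x y} → x ~ y → value x y ≈ value y x
      1≤value   : ∀ {x y} → x ~ y → 1# ≤ value x y

    toWeight : Weight
    toWeight = record
      { ⟦_⟧ = value
      ; symmetric = symmetric
      ; positive = λ e → ≤-trans 0≤1 (1≤value e) ,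
                   λ 0≈v → 0≉1 (antisym 0≤1 (≤-respʳ (sym 0≈v) (1≤value e)))
      }

  open Box public using (value; toWeight)

  -- A u v x is A_{u∣v}(x): the edges at u other than uv are the uz with z ≢ v.
  A : Fin n → Fin n → Box → Carrier
  A u v x = ∑[ z < n ] (if does ((u ~? z) ×-dec ¬? (z ≟ᶠ v)) then value x u z else 0#)

  A-nonNeg : ∀ u v x → 0# ≤ A u v x
  A-nonNeg u v x = sum-nonNeg _ term
    where
    term : ∀ z → 0# ≤ (if does ((u ~? z) ×-dec ¬? (z ≟ᶠ v)) then value x u z else 0#)
    term z with u ~? z | z ≟ᶠ v
    ... | yes e | no _  = ≤-trans 0≤1 (Box.1≤value x e)
    ... | yes _ | yes _ = ≤-refl
    ... | no _  | _     = ≤-refl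

  F : Box → Box
  F x = record
    { value     = λ u v → 1# ⊔ √ (AA-nonNeg u v)
    ; symmetric = λ {u} {v} _ → ⊔-cong refl (√-cong _ _ (*-comm (A u v x) (A v u x)))
    ; 1≤value   = λ _ → x≤x⊔y _ _
    }
    where
    open Max totalOrder using (⊔-cong; x≤x⊔y)
    AA-nonNeg : ∀ u v → 0# ≤ A u v x * A v u x
    AA-nonNeg u v = *-nonNeg (A-nonNeg u v x) (A-nonNeg v u x)

  IsFixedPoint : Pred Box 0ℓ
  IsFixedPoint x = value (F x) ≈ᴱ value x

------------------------------------------------------------------------
-- Lin–Lu–Yau curvature and distortion
--
-- Quantities given by an infimum, a supremum or a limit are introduced as
-- relations "the quantity exists and equals …"; each determines its value
-- up to ≈.

module Curvature (ℝ : CompleteOrderedField) {n} (G : SimpleGraph n)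
                 (connected : Connected G) where
  open CompleteOrderedField ℝ
  open SimpleGraph G
  open EdgeFunctions ℝ G public

  weightedDegree : Weight → Fin n → Carrier
  weightedDegree w x = ∑[ y < n ] (if does (x ~? y) then ⟦ w ⟧ x y else 0#)

  μ : Carrier → Weight → Fin n → Fin n → Carrier
  μ α w x z =
    if does (z ≟ᶠ x) then α else
    if does (x ~? z) then (1# - α) * ⟦ w ⟧ x z / weightedDegree w x else 0#

  record IsCoupling (μ ν : Fin n → Carrier) (π : Fin n → Fin n → Carrier) : Set where
    field
      nonNeg    : ∀ u v → 0# ≤ π u v
      marginalˡ : ∀ u → ∑[ v < n ] π u v ≈ μ u
      marginalʳ : ∀ v → ∑[ u < n ] π u v ≈ ν v

  -- k · r is the sum of k copies of r.
  cost : (Fin n → Fin n → Carrier) → Carrier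
  cost π = ∑[ u < n ] ∑[ v < n ] (dist G connected u v · π u v)

  IsW₁ : (μ ν : Fin n → Carrier) → Pred Carrier 0ℓ
  IsW₁ μ ν = IsInfimum _≤_ λ c → ∃ λ π → IsCoupling μ ν π × c ≈ cost π

  Isκ : Carrier → Weight → (x y : Fin n) → Pred Carrier 0ℓ
  Isκ α w x y k = ∃ λ c → IsW₁ (μ α w x) (μ α w y) c × k ≈ 1# - c

  IsκLLY : Weight → (x y : Fin n) → Pred Carrier 0ℓ
  IsκLLY w x y l =
    ∀ ε → 0# < ε → ∃ λ δ → 0# < δ ×
    (∀ α → 0# ≤ α → 1# - δ < α → α < 1# →
      ∃ λ k → Isκ α w x y k × ∣ k / (1# - α) - l ∣ < ε)

  Admissible : Pred Weight 0ℓ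
  Admissible w = ∀ {x y} → x ~ y → ∃ λ κ → IsκLLY w x y κ × 0# ≤ κ

  data IsDist (w : Weight) : Pred (Carrier ⁺) 0ℓ where
    finite       : ∀ {M m D} → IsSupremum _≤_ (EdgeValue ⟦ w ⟧) M →
                   IsInfimum _≤_ (EdgeValue ⟦ w ⟧) m → 0# < m → D ≈ M / m →
                   IsDist w [ D ]
    sup-infinite : ¬ ∃ (UpperBound _≤_ (EdgeValue ⟦ w ⟧)) → IsDist w ⊤⁺
    inf-zero     : IsInfimum _≤_ (EdgeValue ⟦ w ⟧) 0# → IsDist w ⊤⁺

  open AddSupremum _≤_ public using (_≤⁺_)

  IsDN : Pred (Carrier ⁺) 0ℓ
  IsDN = IsInfimum _≤⁺_ λ D → ∃ λ w → Admissible w × IsDist w D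

  Optimal : Pred Weight 0ℓ
  Optimal w = Admissible w × ∃ λ D → IsDist w D × IsDN D

  Normalized : Pred Weight 0ℓ
  Normalized w = (∃ λ D → IsDist w [ D ]) × IsInfimum _≤_ (EdgeValue ⟦ w ⟧) 1#

{-# OPTIONS --safe #-}
-- On a tree the distances between the balls around adjacent x and y are all read off
-- from the edge xy, so the transport problem is solved explicitly and
-- κ(x,y) = 2 (w_xy / d_x + w_xy / d_y − 1).  Clearing denominators, this is nonnegative
-- (zero) iff w_xy² is at least (equal to) A_{x∣y}(w) A_{y∣x}(w).  Hence a weight with
-- values in [1,∞) is admissible iff F w ≤ w.  Such weights exist: let the weight decay
-- like N^(−k²) in the depth k of the edge.  As F is monotone, their infimum is a fixed
-- point w★, the least admissible weight.  Uniqueness of the fixed point and of the optimal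
-- weight both propagate an equality w_xy² = A_{x∣y} A_{y∣x} from an edge to the edges
-- beyond it, and an edge with w★ > 1 always continues, which cannot go on forever in a
-- finite tree.

module Submission where

open import Defs
open import Data.Bool.Base using (if_then_else_)
open import Data.Empty using (⊥-elim)
open import Data.Fin.Base using (Fin; zero; suc; punchIn)
open import Data.Fin.Properties using (any?; injective⇒≤; punchInᵢ≢i) renaming (_≟_ to _≟ᶠ_)
open import Data.List.Base using (List; []; _∷_; length; lookup; filter; cartesianProduct; allFin)
open import Data.List.Membership.Propositional using (_∈_)
open import Data.List.Membership.Propositional.Properties
  using (∈-lookup; ∈-filter⁺; ∈-cartesianProduct⁺; ∈-allFin)
open import Data.List.Properties using (∷-injectiveˡ; ∷-injectiveʳ)
open import Data.List.Relation.Binary.Subset.Propositional using (_⊆_)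
open import Data.List.Relation.Binary.Subset.Propositional.Properties using (All-resp-⊇; ∷⁺ʳ)
open import Data.List.Relation.Unary.All as All using (All; []; _∷_)
open import Data.List.Relation.Unary.All.Properties using (all-filter)
open import Data.List.Relation.Unary.AllPairs as AllPairs using ([]; _∷_)
open import Data.List.Relation.Unary.Any using (here; there)
open import Data.List.Relation.Unary.Unique.Propositional using (Unique)
open import Data.List.Relation.Unary.Unique.Propositional.Properties using (filter⁺; allFin⁺)
open import Data.Nat.Base as ℕ using (ℕ; zero; suc; z≤n; s≤s)
import Data.Nat.Properties as ℕ
open import Data.Nat.Solver using (module +-*-Solver)
open import Data.Product.Base using (∃; ∃₂; Σ; _×_; _,_; proj₁; proj₂)
open import Data.Sum.Base using (_⊎_; inj₁; inj₂; [_,_]′)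
open import Data.Unit.Base using (⊤; tt)
open import Function.Base using (_∘_; id)
open import Level using (0ℓ)
open import Relation.Binary.Bundles using (TotalOrder)
open import Relation.Binary.Construct.Add.Supremum.NonStrict using (_≤⊤⁺; [_]; [≤]-injective)
open import Relation.Binary.PropositionalEquality as ≡ using (_≡_; _≢_)
open import Relation.Nullary using (¬_; Dec; yes; no; does)
open import Relation.Nullary.Construct.Add.Supremum using ([_]; ⊤⁺)
open import Relation.Nullary.Decidable using (¬?; _×-dec_)
open import Relation.Unary using (Pred; Decidable)
import Algebra.Construct.NaturalChoice.Max as Max
import Algebra.Properties.CommutativeMonoid.Sum as MonoidSum
import Algebra.Properties.Monoid.Mult as MonoidMult
import Algebra.Properties.Semiring.Mult as SemiringMult
import Algebra.Properties.Semiring.Sum as SemiringSum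
import Algebra.Solver.Ring.NaturalCoefficients.Default as Solver
import Data.List.Extrema as Extrema
import Relation.Binary.Reasoning.PartialOrder as ≤-Reasoning


-- Where the cutoff at 1 is inactive, `F` is homogeneous of degree one, so strict contraction does
-- not drive the argument: existence comes from order alone, and uniqueness has to use the tree. For
-- two fixed points the propagation starts where their ratio is largest and runs outwards in one
-- direction until it contradicts finiteness. For an optimal weight it starts at an edge where w★ is
-- largest, runs in both directions and covers the whole tree. The limit in the curvature is
-- harmless: for α > 1/2 each centre carries more mass than the other measure puts on it, the shape
-- of the optimal plan no longer changes, and κ_α is exactly linear in 1 - α. The exponent k² comes
-- from second differences: the edges on the two sides of an edge have depths at least k and k + 2,
-- each sum costs a factor of at most N, and k² has second difference 2, which pays for N².

-- Non-backtracking walks in a graph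

lookup-injective : ∀ {A : Set} {xs : List A} → Unique xs → ∀ {i j} → lookup xs i ≡ lookup xs j → i ≡ j
lookup-injective (_   ∷ _) {zero}  {zero}  _  = ≡.refl
lookup-injective (x∉  ∷ _) {zero}  {suc j} eq = ⊥-elim (All.lookup x∉ (∈-lookup j) eq)
lookup-injective (x∉  ∷ _) {suc i} {zero}  eq = ⊥-elim (All.lookup x∉ (∈-lookup i) (≡.sym eq))
lookup-injective (_   ∷ u) {suc i} {suc j} eq = ≡.cong suc (lookup-injective u eq)

module Walks {n} (G : SimpleGraph n) where
  open SimpleGraph G

  -- Only the second vertex is tested: for a walk entered from `x`, this excludes turning straight
  -- back to `x`.
  Avoids : ∀ {y z k} → Fin n → Walk G y z k → Set
  Avoids x stop             = ⊤
  Avoids x (step {y = y} _ _) = x ≢ y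

  NonBacktracking : ∀ {x y k} → Walk G x y k → Set
  NonBacktracking stop           = ⊤
  NonBacktracking (step {x} _ p) = Avoids x p × NonBacktracking p

  record NBWalk (x y : Fin n) (k : ℕ) : Set where
    constructor _⊣_
    field
      walk : Walk G x y k
      nb   : NonBacktracking walk

  end∈vertices : ∀ {x y k} (p : Walk G x y k) → y ∈ vertices G p
  end∈vertices stop       = here ≡.refl
  end∈vertices (step _ p) = there (end∈vertices p)

  length-vertices : ∀ {x y k} (p : Walk G x y k) → length (vertices G p) ≡ suc k
  length-vertices stop       = ≡.refl
  length-vertices (step _ p) = ≡.cong suc (length-vertices p)

  reduce : ∀ {x y k} → Walk G x y k → ∃ λ j → j ℕ.≤ k × NBWalk x y j
  reduce stop = 0 , z≤n , stop ⊣ tt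
  reduce (step {x} e p) with reduce p
  ... | _ , j≤k , stop ⊣ _ = _ , s≤s j≤k , step e stop ⊣ _
  ... | _ , j≤k , step {y = z} f q ⊣ nb with x ≟ᶠ z
  ...   | yes ≡.refl = _ , ℕ.m≤n⇒m≤1+n (ℕ.<⇒≤ j≤k) , q ⊣ proj₂ nb
  ...   | no x≢z     = _ , s≤s j≤k , step e (step f q) ⊣ (x≢z , nb)

  -- Joins the reverse of `p` to `q` through `e`. The edges of `p` move one at a time to the front
  -- of `q`, so the turn at each vertex is checked exactly when it becomes the joint.
  reverse-append : ∀ {a a′ b c k l} (e : a ~ a′) (p : Walk G a′ b k) (q : Walk G a c l) →
                   Avoids a p → NonBacktracking p → Avoids a′ q → NonBacktracking q →
                   ∃ λ m → NBWalk b c (suc m)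
  reverse-append e stop q _ _ a′q nbq = _ , step (~-sym e) q ⊣ (a′q , nbq)
  reverse-append e (step f p) q a≢ (a′p , nbp) a′q nbq =
    reverse-append f p (step (~-sym e) q) a′p nbp (a≢ ∘ ≡.sym) (a′q , nbq)

  -- Either the new first step survives or it cancels against the old one. This is why the distances
  -- of two adjacent vertices of a tree to a third differ by exactly one.
  neighbour-walk : ∀ {x y z k} → x ~ y → NBWalk y z k →
                   NBWalk x z (suc k) ⊎ (∃ λ j → k ≡ suc j × NBWalk x z j)
  neighbour-walk e (stop ⊣ _) = inj₁ (step e stop ⊣ _)
  neighbour-walk {x} e (step {y = z} f p ⊣ nb) with x ≟ᶠ z
  ... | yes ≡.refl = inj₂ (_ , ≡.refl , p ⊣ proj₂ nb)
  ... | no x≢z     = inj₁ (step e (step f p) ⊣ (x≢z , nb))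

  unique-length : ∀ {xs : List (Fin n)} → Unique xs → length xs ℕ.≤ n
  unique-length u = injective⇒≤ (lookup-injective u)

  prefix : ∀ {x y z k} (p : Walk G y z k) → Unique (vertices G p) → x ∈ vertices G p →
           ∃ λ j → Σ (Walk G y x j) λ q → Unique (vertices G q) × vertices G q ⊆ vertices G p
  prefix stop       u       (here ≡.refl) = 0 , stop , u , id
  prefix (step e p) (_ ∷ _) (here ≡.refl) = 0 , stop , [] ∷ [] , λ { (here eq) → here eq }
  prefix (step e p) (y∉ ∷ u) (there x∈) with prefix p u x∈
  ... | j , q , uq , q⊆p = suc j , step e q , All-resp-⊇ q⊆p y∉ ∷ uq , ∷⁺ʳ _ q⊆p

-- Distances and depth in a tree

module TreeWalks {n} {T : SimpleGraph n} (tree : IsTree T) where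
  open SimpleGraph T
  open IsTree tree
  open Walks T public

  -- The tail is a path by induction. If it returned to `x`, its initial piece and the edge `e`
  -- would form a cycle; not turning back guarantees that this piece has at least two edges, as
  -- `acyclic` demands.
  nonBacktracking⇒unique : ∀ {x y k} (p : Walk T x y k) → NonBacktracking p → Unique (vertices T p)
  nonBacktracking⇒unique stop _ = [] ∷ []
  nonBacktracking⇒unique (step {x} {y} e p) (x∤p , nb) = All.tabulate x≢ ∷ unique
    where
    unique = nonBacktracking⇒unique p nb
    no-return : ∀ {z k} (p : Walk T y z k) → Avoids x p → Unique (vertices T p) → ¬ x ∈ vertices T p
    no-return stop       _   _        (here ≡.refl) = ~-irr e
    no-return (step f p) _   _        (here ≡.refl) = ~-irr e
    no-return (step f p) x≢z (y∉ ∷ u) (there x∈) with prefix p u x∈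
    ... | zero  , stop , _ , _ = x≢z ≡.refl
    ... | suc j , q , uq , q⊆p =
      acyclic (step f q) (s≤s (s≤s z≤n)) (All-resp-⊇ q⊆p y∉ ∷ uq) e
    x≢ : ∀ {z} → z ∈ vertices T p → x ≢ z
    x≢ z∈p ≡.refl = no-return p x∤p unique z∈p

  no-closed-nonBacktracking : ∀ {x k} → ¬ NBWalk x x (suc k)
  no-closed-nonBacktracking (step e p ⊣ nb) =
    All.lookup (AllPairs.head (nonBacktracking⇒unique (step e p) nb)) (end∈vertices p) ≡.refl

  -- Where two walks diverge, the reverse of one followed by the other is a closed non-backtracking
  -- walk. Vertex lists are compared because two walks may carry different proofs of the same
  -- adjacency.
  nonBacktracking-unique : ∀ {x y k l} (p : Walk T x y k) (q : Walk T x y l) →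
    NonBacktracking p → NonBacktracking q → vertices T p ≡ vertices T q
  nonBacktracking-unique stop stop _ _ = ≡.refl
  nonBacktracking-unique stop (step f q) _ nbq = ⊥-elim (no-closed-nonBacktracking (step f q ⊣ nbq))
  nonBacktracking-unique (step e p) stop nbp _ = ⊥-elim (no-closed-nonBacktracking (step e p ⊣ nbp))
  nonBacktracking-unique (step {y = y} e p) (step {y = z} f q) (xp , nbp) (xq , nbq) with y ≟ᶠ z
  ... | yes ≡.refl = ≡.cong (_ ∷_) (nonBacktracking-unique p q nbp nbq)
  ... | no y≢z = ⊥-elim (no-closed-nonBacktracking
                   (proj₂ (reverse-append e p (step f q) xp nbp y≢z (xq , nbq))))

  nonBacktracking-length : ∀ {x y k l} → NBWalk x y k → NBWalk x y l → k ≡ l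
  nonBacktracking-length (p ⊣ nbp) (q ⊣ nbq) = ℕ.suc-injective
    (≡.trans (≡.sym (length-vertices p))
      (≡.trans (≡.cong length (nonBacktracking-unique p q nbp nbq)) (length-vertices q)))

  -- A shortest walk cannot get shorter by reduction, so its reduced form still has length `dist`.
  geodesic : ∀ x y → NBWalk x y (dist T connected x y)
  geodesic x y with least (walk? T x y) (proj₁ (connected x y)) (proj₂ (connected x y))
  ... | m , p , m≤ with reduce p
  ... | j , j≤m , q with ℕ.≤-antisym j≤m (m≤ j (NBWalk.walk q))
  ... | ≡.refl = q

  dist≡ : ∀ {x y k} → NBWalk x y k → dist T connected x y ≡ k
  dist≡ p = nonBacktracking-length (geodesic _ _) p

  -- The walk is stored backwards, from its current head `v`, so that a continuation becomes a new
  -- first step; the clause about `Avoids` records that its second vertex is `u`. After enough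
  -- continuations it has more than n distinct vertices.
  no-escape : (Q : Fin n → Fin n → Set) → (∀ {u v} → Q u v → u ~ v) →
              (∀ {u v} → Q u v → ∃ λ z → z ≢ u × Q v z) → ∀ {u v} → ¬ Q u v
  no-escape Q Q⇒~ continue {u} {v} q₀ with long n
    where
    long : ∀ k → ∃ λ a → ∃₂ λ u v → Q u v × ∃ λ (w : NBWalk v a (suc k)) → ∀ {z} → z ≢ u → Avoids z (NBWalk.walk w)
    long zero = _ , u , v , q₀ , step (~-sym (Q⇒~ q₀)) stop ⊣ _ , id
    long (suc k) with long k
    ... | a , u , v , q , w ⊣ nb , avoid with continue q
    ... | z , z≢u , q′ = a , v , z , q′ , step (~-sym (Q⇒~ q′)) w ⊣ (avoid z≢u , nb) , id
  ... | _ , _ , _ , _ , w ⊣ nb , _ =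
    ℕ.1+n≰n (ℕ.≤-trans (ℕ.n≤1+n _)
      (≡.subst (ℕ._≤ n) (length-vertices w) (unique-length (nonBacktracking⇒unique w nb))))

  module Rooted (r : Fin n) where

    depth : Fin n → ℕ
    depth x = dist T connected x r

    depth-neighbour : ∀ {x y} → x ~ y → depth x ≡ suc (depth y) ⊎ depth y ≡ suc (depth x)
    depth-neighbour {x} {y} e with neighbour-walk e (geodesic y r)
    ... | inj₁ p           = inj₁ (dist≡ p)
    ... | inj₂ (j , eq , p) = inj₂ (≡.trans eq (≡.cong suc (≡.sym (dist≡ p))))

    -- The geodesics of `u` and `u′` to the root both extend to non-backtracking walks from `v`: one
    -- that began by stepping to `v` would make `v` nearer to the root than its parent. Uniqueness
    -- of such walks identifies their second vertices.
    parent-unique : ∀ {v u u′} → v ~ u → v ~ u′ →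
                    depth v ≡ suc (depth u) → depth v ≡ suc (depth u′) → u ≡ u′
    parent-unique {v} {u} {u′} e e′ eq eq′ =
      second≡ {p = proj₁ (extend e eq)} {proj₁ (extend e′ eq′)}
        (nonBacktracking-unique (step e _) (step e′ _) (proj₂ (extend e eq)) (proj₂ (extend e′ eq′)))
      where
      extend : ∀ {u} (e : v ~ u) → depth v ≡ suc (depth u) →
               ∃ λ (p : Walk T u r (depth u)) → NonBacktracking (step e p)
      extend {u} e eq with geodesic u r
      ... | p ⊣ nb = p , avoids p nb , nb
        where
        avoids : ∀ {k} (p : Walk T u r k) → NonBacktracking p → Avoids v p
        avoids stop _ = tt
        avoids (step f q) nb ≡.refl = ℕ.<⇒≢ (ℕ.m<n⇒m<1+n ℕ.≤-refl)
          (≡.trans (≡.sym (dist≡ (q ⊣ proj₂ nb))) (≡.trans eq (≡.cong suc (dist≡ (step f q ⊣ nb)))))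
      second≡ : ∀ {k l} {p : Walk T u r k} {q : Walk T u′ r l} →
                vertices T (step e p) ≡ vertices T (step e′ q) → u ≡ u′
      second≡ {p = p} {q} eq = head≡ p q (∷-injectiveʳ eq)
        where
        head≡ : ∀ {k l} (p : Walk T u r k) (q : Walk T u′ r l) → vertices T p ≡ vertices T q → u ≡ u′
        head≡ stop       stop       = ∷-injectiveˡ
        head≡ stop       (step _ _) = ∷-injectiveˡ
        head≡ (step _ _) stop       = ∷-injectiveˡ
        head≡ (step _ _) (step _ _) = ∷-injectiveˡ

-- Ordered-field arithmetic

module OrderedField (ℝ : CompleteOrderedField) where
  open CompleteOrderedField ℝ public hiding (zero)
  open SquareRoot ℝ public
  open Solver commutativeSemiring public using (solve; _:=_; _:+_; _:*_; con)

  module ≤R = ≤-Reasoning (TotalOrder.poset totalOrder)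

  <⇒≤ : ∀ {x y} → x < y → x ≤ y
  <⇒≤ = proj₁

  <⇒≱ : ∀ {x y} → x < y → ¬ y ≤ x
  <⇒≱ (x≤y , x≉y) y≤x = x≉y (antisym x≤y y≤x)

  ≰⇒> : ∀ {x y} → ¬ y ≤ x → x < y
  ≰⇒> {x} {y} y≰x with total x y
  ... | inj₁ x≤y = x≤y , y≰x ∘ ≤-reflexive ∘ sym
  ... | inj₂ y≤x = ⊥-elim (y≰x y≤x)

  ≮⇒≥ : ∀ {x y} → ¬ x < y → y ≤ x
  ≮⇒≥ {x} {y} x≮y with y ≤? x
  ... | yes y≤x = y≤x
  ... | no y≰x  = ⊥-elim (x≮y (≰⇒> y≰x))

  <-≤-trans : ∀ {x y z} → x < y → y ≤ z → x < z
  <-≤-trans x<y y≤z = ≰⇒> λ z≤x → <⇒≱ x<y (≤-trans y≤z z≤x)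

  ≤-<-trans : ∀ {x y z} → x ≤ y → y < z → x < z
  ≤-<-trans x≤y y<z = ≰⇒> λ z≤x → <⇒≱ y<z (≤-trans z≤x x≤y)

  0<1 : 0# < 1#
  0<1 = 0≤1 , 0≉1

  +-mono-≤ : ∀ {x y u v} → x ≤ y → u ≤ v → x + u ≤ y + v
  +-mono-≤ {x} {y} {u} {v} x≤y u≤v = ≤-trans (+-monoʳ-≤ x u≤v)
    (≤-respˡ (+-comm v x) (≤-respʳ (+-comm v y) (+-monoʳ-≤ v x≤y)))

  +-cancelˡ-≈ : ∀ x {y z} → x + y ≈ x + z → y ≈ z
  +-cancelˡ-≈ x p = antisym (+-cancelˡ-≤ x (≤-reflexive p)) (+-cancelˡ-≤ x (≤-reflexive (sym p)))

  x+z≈y⇒x≈y-z : ∀ {x y z} → x + z ≈ y → x ≈ y - z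
  x+z≈y⇒x≈y-z {x} {y} {z} p = +-cancelˡ-≈ z (trans (+-comm z x) (trans p (sym
    (trans (+-comm z _) (trans (+-assoc y (- z) z) (trans (+-congˡ (-‿inverseˡ z)) (+-identityʳ y)))))))

  y-z+z≈y : ∀ y z → y - z + z ≈ y
  y-z+z≈y y z = trans (+-assoc y (- z) z) (trans (+-congˡ (-‿inverseˡ z)) (+-identityʳ y))

  *-mono-≤ : ∀ {x y u v} → 0# ≤ x → 0# ≤ u → x ≤ y → u ≤ v → x * u ≤ y * v
  *-mono-≤ {x} {y} {u} {v} 0≤x 0≤u x≤y u≤v = ≤-trans (*-monoʳ-≤ 0≤x u≤v)
    (≤-respˡ (*-comm v x) (≤-respʳ (*-comm v y) (*-monoʳ-≤ (≤-trans 0≤u u≤v) x≤y)))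

  *-monoˡ-≤ : ∀ {x y z} → 0# ≤ x → y ≤ z → y * x ≤ z * x
  *-monoˡ-≤ 0≤x y≤z = ≤-respˡ (*-comm _ _) (≤-respʳ (*-comm _ _) (*-monoʳ-≤ 0≤x y≤z))

  0<⇒≉0 : ∀ {x} → 0# < x → ¬ x ≈ 0#
  0<⇒≉0 0<x = proj₂ 0<x ∘ sym

  ⁻¹-inverseʳ : ∀ {x} → 0# < x → x * x ⁻¹ ≈ 1#
  ⁻¹-inverseʳ {x} 0<x with x ≟ 0#
  ... | yes x≈0 = ⊥-elim (0<⇒≉0 0<x x≈0)
  ... | no x≉0  = proj₂ (inverse x x≉0)

  ⁻¹-inverseˡ : ∀ {x} → 0# < x → x ⁻¹ * x ≈ 1#
  ⁻¹-inverseˡ 0<x = trans (*-comm _ _) (⁻¹-inverseʳ 0<x)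

  ⁻¹-positive : ∀ {x} → 0# < x → 0# < x ⁻¹
  ⁻¹-positive {x} 0<x = ≰⇒> λ x⁻¹≤0 → <⇒≱ 0<1
    (≤-respˡ (⁻¹-inverseʳ 0<x) (≤-respʳ (zeroʳ x) (*-monoʳ-≤ (<⇒≤ 0<x) x⁻¹≤0)))

  ⁻¹-cancelˡ : ∀ {c} x → 0# < c → c ⁻¹ * (c * x) ≈ x
  ⁻¹-cancelˡ x 0<c = trans (sym (*-assoc _ _ _)) (trans (*-congʳ (⁻¹-inverseˡ 0<c)) (*-identityˡ x))

  x≈y/c⇒cx≈y : ∀ {c x y} → 0# < c → x ≈ y / c → c * x ≈ y
  x≈y/c⇒cx≈y 0<c x≈ = trans (*-congˡ x≈) (trans (*-comm _ _) (trans (*-assoc _ _ _)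
    (trans (*-congˡ (⁻¹-inverseˡ 0<c)) (*-identityʳ _))))

  *-cancelˡ-≤ : ∀ {c x y} → 0# < c → c * x ≤ c * y → x ≤ y
  *-cancelˡ-≤ 0<c p = ≤-respˡ (⁻¹-cancelˡ _ 0<c) (≤-respʳ (⁻¹-cancelˡ _ 0<c)
    (*-monoʳ-≤ (<⇒≤ (⁻¹-positive 0<c)) p))

  *-cancelˡ-≈ : ∀ {c x y} → 0# < c → c * x ≈ c * y → x ≈ y
  *-cancelˡ-≈ 0<c p = trans (sym (⁻¹-cancelˡ _ 0<c)) (trans (*-congˡ p) (⁻¹-cancelˡ _ 0<c))

  *-positive : ∀ {x y} → 0# < x → 0# < y → 0# < x * y
  *-positive {x} {y} 0<x 0<y = ≰⇒> λ xy≤0 → <⇒≱ 0<y (*-cancelˡ-≤ 0<x (≤-respʳ (sym (zeroʳ x)) xy≤0))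

  +-positiveˡ : ∀ {x y} → 0# < x → 0# ≤ y → 0# < x + y
  +-positiveˡ 0<x 0≤y = <-≤-trans 0<x (x≤x+y 0≤y)

  square-cancel-≤ : ∀ {x y} → 0# ≤ x → 0# ≤ y → x * x ≤ y * y → x ≤ y
  square-cancel-≤ {x} {y} 0≤x 0≤y xx≤yy with total x y
  ... | inj₁ x≤y = x≤y
  ... | inj₂ y≤x = ≤-reflexive (square-injective 0≤x 0≤y (antisym xx≤yy (square-mono-≤ 0≤y y≤x)))

  -- The algebraic core of propagation: a′b ≤ a′b′ ≤ ab, and b cancels because ab > 0 makes it
  -- positive.
  *-squeeze : ∀ {a a′ b b′} → 0# ≤ a → 0# ≤ b → a ≤ a′ → b ≤ b′ →
              0# < a * b → a′ * b′ ≤ a * b → a′ ≤ a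
  *-squeeze {a} {a′} {b} {b′} 0≤a 0≤b a≤a′ b≤b′ 0<ab a′b′≤ab = *-cancelˡ-≤ 0<b
    (≤-respˡ (*-comm _ _) (≤-respʳ (*-comm _ _) (≤-trans (*-monoʳ-≤ (≤-trans 0≤a a≤a′) b≤b′) a′b′≤ab)))
    where
    0<b : 0# < b
    0<b = 0≤b , λ 0≈b → proj₂ 0<ab (sym (trans (*-congˡ (sym 0≈b)) (zeroʳ a)))

  infimum : ∀ (P : Pred Carrier 0ℓ) → ∃ P → ∃ (LowerBound _≤_ P) → ∃ (IsInfimum _≤_ P)
  infimum P p (b , b≤) with supremum (LowerBound _≤_ P) (b , b≤) (proj₁ p , λ a a≤ → a≤ _ (proj₂ p))
  ... | s , ub , least = s , (λ a pa → least a λ c c≤ → c≤ a pa) , ub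

  infimum-unique : ∀ {P : Pred Carrier 0ℓ} {x y} → IsInfimum _≤_ P x → IsInfimum _≤_ P y → x ≈ y
  infimum-unique (x≤ , x-greatest) (y≤ , y-greatest) = antisym (y-greatest _ x≤) (x-greatest _ y≤)

-- Finite sums and conditional summands

module Sums (ℝ : CompleteOrderedField) where
  open OrderedField ℝ
  open MonoidSum +-commutativeMonoid
    using (sum-remove; sum-cong-≋; sum-replicate-zero; ∑-distrib-+; ∑-comm)
  open SemiringSum semiring using (*-distribˡ-sum)

  -- The number of terms is explicit because unification cannot recover it from a sum.

  sum-cong : ∀ n {f g : Fin n → Carrier} → (∀ i → f i ≈ g i) → ∑[ i < n ] f i ≈ ∑[ i < n ] g i
  sum-cong n = sum-cong-≋ {n}

  sum-zero : ∀ n {f : Fin n → Carrier} → (∀ i → f i ≈ 0#) → ∑[ i < n ] f i ≈ 0#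
  sum-zero n f≈0 = trans (sum-cong n f≈0) (sum-replicate-zero n)

  sum-+ : ∀ n (f g : Fin n → Carrier) → ∑[ i < n ] (f i + g i) ≈ ∑[ i < n ] f i + ∑[ i < n ] g i
  sum-+ n = ∑-distrib-+ {n}

  sum-swap : ∀ m n (f : Fin m → Fin n → Carrier) →
             ∑[ i < m ] ∑[ j < n ] f i j ≈ ∑[ j < n ] ∑[ i < m ] f i j
  sum-swap m n = ∑-comm {m} {n}

  sum-*ˡ : ∀ n c (f : Fin n → Carrier) → ∑[ i < n ] (c * f i) ≈ c * ∑[ i < n ] f i
  sum-*ˡ n c f = sym (*-distribˡ-sum {n} c f)

  sum-mono-≤ : ∀ n {f g : Fin n → Carrier} → (∀ i → f i ≤ g i) → ∑[ i < n ] f i ≤ ∑[ i < n ] g i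
  sum-mono-≤ zero    f≤g = ≤-refl
  sum-mono-≤ (suc n) f≤g = +-mono-≤ (f≤g zero) (sum-mono-≤ n (f≤g ∘ suc))

  sum≤· : ∀ n {f : Fin n → Carrier} {c} → (∀ i → f i ≤ c) → ∑[ i < n ] f i ≤ n · c
  sum≤· zero    f≤c = ≤-refl
  sum≤· (suc n) f≤c = +-mono-≤ (f≤c zero) (sum≤· n (f≤c ∘ suc))

  term≤sum : ∀ n {f : Fin n → Carrier} → (∀ i → 0# ≤ f i) → ∀ i → f i ≤ ∑[ i < n ] f i
  term≤sum (suc n) 0≤f zero    = x≤x+y (sum-nonNeg _ (0≤f ∘ suc))
  term≤sum (suc n) 0≤f (suc i) = ≤-trans (term≤sum n (0≤f ∘ suc) i) (≤-respʳ (+-comm _ _) (x≤x+y (0≤f zero)))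

  sum-tight : ∀ n {f g : Fin n → Carrier} → (∀ i → f i ≤ g i) →
              ∑[ i < n ] g i ≤ ∑[ i < n ] f i → ∀ i → g i ≤ f i
  sum-tight (suc n) {f} {g} f≤g p zero = +-cancelˡ-≤ (∑[ i < n ] g (suc i)) (≤-respˡ (+-comm _ _)
    (≤-trans p (≤-respˡ (+-comm _ _) (≤-respˡ (+-comm _ _)
      (≤-respʳ (+-comm _ _) (+-monoʳ-≤ (f zero) (sum-mono-≤ n (f≤g ∘ suc))))))))
  sum-tight (suc n) {f} {g} f≤g p (suc i) = sum-tight n (f≤g ∘ suc)
    (+-cancelˡ-≤ (g zero) (≤-trans p (+-mono-≤ (f≤g zero) ≤-refl))) i

  infixl 9 _when_

  -- Unfolds to the very `if does` expression in the summands of `A` and `weightedDegree`, so the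
  -- lemmas below apply to those sums as they stand.
  _when_ : {P : Set} → Carrier → Dec P → Carrier
  x when P? = if does P? then x else 0#

  when-true : ∀ {P : Set} (P? : Dec P) {x} → P → x when P? ≈ x
  when-true (yes _) _ = refl
  when-true (no ¬p) p = ⊥-elim (¬p p)

  when-false : ∀ {P : Set} (P? : Dec P) {x} → ¬ P → x when P? ≈ 0#
  when-false (yes p) ¬p = ⊥-elim (¬p p)
  when-false (no _)  _  = refl

  when-nonNeg : ∀ {P : Set} (P? : Dec P) {x} → (P → 0# ≤ x) → 0# ≤ x when P?
  when-nonNeg (yes p) 0≤x = 0≤x p
  when-nonNeg (no _)  _   = ≤-refl

  when-cong : ∀ {P : Set} (P? : Dec P) {x y} → (P → x ≈ y) → x when P? ≈ y when P?
  when-cong (yes p) x≈y = x≈y p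
  when-cong (no _)  _   = refl

  when-mono-≤ : ∀ {P : Set} (P? : Dec P) {x y} → (P → x ≤ y) → x when P? ≤ y when P?
  when-mono-≤ (yes p) x≤y = x≤y p
  when-mono-≤ (no _)  _   = ≤-refl

  *-when : ∀ {P : Set} (P? : Dec P) c x → (c * x) when P? ≈ c * x when P?
  *-when (yes _) c x = refl
  *-when (no _)  c x = sym (zeroʳ c)

  sum-point : ∀ n (i : Fin n) (f : Fin n → Carrier) → ∑[ j < n ] (f j when (j ≟ᶠ i)) ≈ f i
  sum-point (suc n) i f = begin-equality
    sum g                                    ≈⟨ sum-remove {i = i} g ⟩
    g i + sum (λ j → g (punchIn i j))        ≈⟨ +-cong (when-true (i ≟ᶠ i) ≡.refl)
                                                 (sum-zero n λ j → when-false (punchIn i j ≟ᶠ i) (punchInᵢ≢i i j)) ⟩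
    f i + 0#                                 ≈⟨ +-identityʳ _ ⟩
    f i                                      ∎
    where
    open ≤R
    g : Fin (suc n) → Carrier
    g j = f j when (j ≟ᶠ i)

-- Transport duality

-- Optimality of an explicit coupling is certified by integer potentials φ, ψ
-- (complementary slackness), which are shifted by N so as to be natural numbers.
module Transport (ℝ : CompleteOrderedField) {n} {T : SimpleGraph n} (tree : IsTree T) where
  open OrderedField ℝ
  open Sums ℝ
  open IsTree tree
  open Curvature ℝ T connected
  open MonoidMult +-monoid using () renaming (×-homo-+ to ·-homo-+; ×-congʳ to ·-congʳ)
  open IsCoupling

  d : Fin n → Fin n → ℕ
  d = dist T connected

  ·-mono-≤ : ∀ {k l r} → 0# ≤ r → k ℕ.≤ l → k · r ≤ l · r
  ·-mono-≤ {l = zero}  0≤r z≤n       = ≤-refl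
  ·-mono-≤ {l = suc l} 0≤r z≤n       = +-nonNeg 0≤r (·-mono-≤ {l = l} 0≤r z≤n)
  ·-mono-≤             0≤r (s≤s k≤l) = +-monoʳ-≤ _ (·-mono-≤ 0≤r k≤l)

  k·0≈0 : ∀ k {r} → r ≈ 0# → k · r ≈ 0#
  k·0≈0 zero    r≈0 = refl
  k·0≈0 (suc k) r≈0 = trans (+-cong r≈0 (k·0≈0 k r≈0)) (+-identityˡ 0#)

  sum-· : ∀ m k (f : Fin m → Carrier) → ∑[ i < m ] (k · f i) ≈ k · ∑[ i < m ] f i
  sum-· m zero    f = sum-zero m λ _ → refl
  sum-· m (suc k) f = trans (sum-+ m f _) (+-congˡ (sum-· m k f))

  module _ {μ ν : Fin n → Carrier} {π : Fin n → Fin n → Carrier} (coupling : IsCoupling μ ν π)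
           (φ ψ : Fin n → ℕ) where

    private
      dual : Carrier
      dual = ∑[ u < n ] (φ u · μ u) + ∑[ v < n ] (ψ v · ν v)

    cost+dual : ∑[ u < n ] ∑[ v < n ] ((d u v ℕ.+ (φ u ℕ.+ ψ v)) · π u v) ≈ cost π + dual
    cost+dual = begin-equality
      ∑[ u < n ] ∑[ v < n ] ((d u v ℕ.+ (φ u ℕ.+ ψ v)) · π u v)
        ≈⟨ sum-cong n (λ u → sum-cong n λ v → trans (·-homo-+ _ (d u v) _) (+-congˡ (·-homo-+ _ (φ u) _))) ⟩
      ∑[ u < n ] ∑[ v < n ] (d u v · π u v + (φ u · π u v + ψ v · π u v))
        ≈⟨ trans (sum-cong n λ u → trans (sum-+ n _ _) (+-congˡ (sum-+ n _ _)))
             (trans (sum-+ n _ _) (+-congˡ (sum-+ n _ _))) ⟩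
      cost π + (∑[ u < n ] ∑[ v < n ] (φ u · π u v) + ∑[ u < n ] ∑[ v < n ] (ψ v · π u v))
        ≈⟨ +-congˡ (+-cong
             (sum-cong n λ u → trans (sum-· n (φ u) _) (·-congʳ (φ u) (marginalˡ coupling u)))
             (trans (sum-swap n n _) (sum-cong n λ v → trans (sum-· n (ψ v) _) (·-congʳ (ψ v) (marginalʳ coupling v))))) ⟩
      cost π + dual ∎
      where open ≤R

    total-mass : ∀ N → ∑[ u < n ] ∑[ v < n ] (N · π u v) ≈ N · ∑[ u < n ] μ u
    total-mass N = trans (sum-cong n λ u → trans (sum-· n N _) (·-congʳ N (marginalˡ coupling u))) (sum-· n N _)

    -- Weak duality. The pointwise bound is demanded on the support only, because the potentials
    -- used later are meaningful only on the balls around the two ends of an edge.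
    dual-bound : ∀ N → (∀ u v → ¬ π u v ≈ 0# → N ℕ.≤ d u v ℕ.+ (φ u ℕ.+ ψ v)) → N · ∑[ u < n ] μ u ≤ cost π + dual
    dual-bound N N≤ = ≤-respˡ (total-mass N) (≤-respʳ cost+dual (sum-mono-≤ n λ u → sum-mono-≤ n λ v → term u v))
      where
      term : ∀ u v → N · π u v ≤ (d u v ℕ.+ (φ u ℕ.+ ψ v)) · π u v
      term u v with π u v ≟ 0#
      ... | yes π≈0 = ≤-reflexive (trans (k·0≈0 N π≈0) (sym (k·0≈0 (d u v ℕ.+ (φ u ℕ.+ ψ v)) π≈0)))
      ... | no π≉0  = ·-mono-≤ (nonNeg coupling u v) (N≤ u v π≉0)

    dual-tight : ∀ N → (∀ u v → ¬ π u v ≈ 0# → d u v ℕ.+ (φ u ℕ.+ ψ v) ≡ N) → cost π + dual ≈ N · ∑[ u < n ] μ u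
    dual-tight N ≡N = trans (sym cost+dual) (trans (sum-cong n λ u → sum-cong n λ v → term u v) (total-mass N))
      where
      term : ∀ u v → (d u v ℕ.+ (φ u ℕ.+ ψ v)) · π u v ≈ N · π u v
      term u v with π u v ≟ 0#
      ... | yes π≈0 = trans (k·0≈0 (d u v ℕ.+ (φ u ℕ.+ ψ v)) π≈0) (sym (k·0≈0 N π≈0))
      ... | no π≉0  = reflexive (≡.cong (_· π u v) (≡N u v π≉0))

  coupling-supportˡ : ∀ {μ ν π} → IsCoupling μ ν π → ∀ {u v} → ¬ π u v ≈ 0# → ¬ μ u ≈ 0#
  coupling-supportˡ coupling {u} {v} π≉0 μ≈0 = π≉0 (antisym
    (≤-trans (term≤sum n (nonNeg coupling u) v) (≤-reflexive (trans (marginalˡ coupling u) μ≈0)))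
    (nonNeg coupling u v))

  coupling-supportʳ : ∀ {μ ν π} → IsCoupling μ ν π → ∀ {u v} → ¬ π u v ≈ 0# → ¬ ν v ≈ 0#
  coupling-supportʳ coupling {u} {v} π≉0 ν≈0 = π≉0 (antisym
    (≤-trans (term≤sum n (λ u → nonNeg coupling u v) u) (≤-reflexive (trans (marginalʳ coupling v) ν≈0)))
    (nonNeg coupling u v))

  -- The mass δ stays in place, and the residual measures are coupled independently.
  module _ {μ ν δ : Fin n → Carrier} {M : Carrier}
           (0≤μ : ∀ u → 0# ≤ μ u) (0≤ν : ∀ u → 0# ≤ ν u) (0≤δ : ∀ u → 0# ≤ δ u)
           (0<M : 0# < M) (∑μ≈M : ∑[ u < n ] μ u ≈ M) (∑ν≈M : ∑[ u < n ] ν u ≈ M) where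

    residual-coupling : Fin n → Fin n → Carrier
    residual-coupling u v = δ u when (u ≟ᶠ v) + μ u * (M ⁻¹ * ν v)

    residual-isCoupling : IsCoupling (λ u → δ u + μ u) (λ v → δ v + ν v) residual-coupling
    residual-isCoupling .nonNeg u v = +-nonNeg (when-nonNeg (u ≟ᶠ v) (λ _ → 0≤δ u))
      (*-nonNeg (0≤μ u) (*-nonNeg (<⇒≤ (⁻¹-positive 0<M)) (0≤ν v)))
    residual-isCoupling .marginalˡ u = trans (sum-+ n _ _) (+-cong
      (trans (sum-cong n λ v → flip-when u v) (sum-point n u (λ _ → δ u)))
      (trans (sum-*ˡ n (μ u) _) (trans (*-congˡ (trans (sum-*ˡ n (M ⁻¹) ν)
        (trans (*-congˡ ∑ν≈M) (⁻¹-inverseˡ 0<M)))) (*-identityʳ _))))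
      where
      flip-when : ∀ u v {r} → r when (u ≟ᶠ v) ≈ r when (v ≟ᶠ u)
      flip-when u v with v ≟ᶠ u
      ... | yes v≡u = when-true (u ≟ᶠ v) (≡.sym v≡u)
      ... | no v≢u  = when-false (u ≟ᶠ v) (v≢u ∘ ≡.sym)
    residual-isCoupling .marginalʳ v = trans (sum-+ n _ _) (+-cong
      (sum-point n v δ)
      (trans (sum-cong n λ u → *-comm _ _) (trans (sum-*ˡ n _ μ)
        (trans (*-congˡ ∑μ≈M) (trans (solve 3 (λ a b c → a :* b :* c := b :* (a :* c)) refl _ _ _)
          (trans (*-congˡ (⁻¹-inverseˡ 0<M)) (*-identityʳ _)))))))

    -- Reduces complementary slackness to two kinds of pairs: diagonal ones that carry `δ`, and
    -- products of the two residual supports.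
    residual-support : ∀ {u v} → ¬ residual-coupling u v ≈ 0# →
                       (u ≡ v × ¬ δ u ≈ 0#) ⊎ (¬ μ u ≈ 0# × ¬ ν v ≈ 0#)
    residual-support {u} {v} π≉0 with μ u ≟ 0# | ν v ≟ 0# | u ≟ᶠ v
    ... | no μ≉0  | no ν≉0  | _       = inj₂ (μ≉0 , ν≉0)
    ... | yes μ≈0 | _       | yes u≡v = inj₁ (u≡v , λ δ≈0 → π≉0
      (trans (+-cong δ≈0 (trans (*-congʳ μ≈0) (zeroˡ _))) (+-identityˡ _)))
    ... | yes μ≈0 | _       | no u≢v  = ⊥-elim (π≉0 (trans (+-congˡ (trans (*-congʳ μ≈0) (zeroˡ _))) (+-identityˡ _)))
    ... | no _    | yes ν≈0 | yes u≡v = inj₁ (u≡v , λ δ≈0 → π≉0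
      (trans (+-cong δ≈0 (trans (*-congˡ (trans (*-congˡ ν≈0) (zeroʳ _))) (zeroʳ _))) (+-identityˡ _)))
    ... | no _    | yes ν≈0 | no u≢v  =
      ⊥-elim (π≉0 (trans (+-congˡ (trans (*-congˡ (trans (*-congˡ ν≈0) (zeroʳ _))) (zeroʳ _))) (+-identityˡ _)))

-- Potentials around an edge of a tree

module BallDistances {n} {T : SimpleGraph n} (tree : IsTree T) where
  open SimpleGraph T
  open IsTree tree
  open TreeWalks tree

  data Side (x y : Fin n) : Fin n → Set where
    centre : Side x y x
    beyond : ∀ {z} → x ~ z → z ≢ y → Side x y z

  data Near (x y : Fin n) : Fin n → Set where
    side  : ∀ {z} → Side x y z → Near x y z
    other : Near x y y

  -- Give height 0 to points beyond x, 1 to x, 2 to y and 3 to points beyond y. Then `potential x y`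
  -- is the height on the ball around x, and `potential y x` is 3 minus the height on the ball
  -- around y. So `Level` is at least 3 when the height rises by at most the distance, and equal to
  -- 3 when it rises by exactly the distance.
  potential : Fin n → Fin n → Fin n → ℕ
  potential x y u = if does (u ≟ᶠ x) then 1 else if does (u ≟ᶠ y) then 2 else 0

  module _ {x y : Fin n} (e : x ~ y) where

    private
      x≢y : x ≢ y
      x≢y ≡.refl = ~-irr e

    potential-centre : potential x y x ≡ 1
    potential-centre with x ≟ᶠ x
    ... | yes _  = ≡.refl
    ... | no x≢x = ⊥-elim (x≢x ≡.refl)

    potential-other : potential x y y ≡ 2
    potential-other with y ≟ᶠ x | y ≟ᶠ y
    ... | yes y≡x | _      = ⊥-elim (x≢y (≡.sym y≡x))
    ... | no _    | yes _  = ≡.refl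
    ... | no _    | no y≢y = ⊥-elim (y≢y ≡.refl)

    potential-beyond : ∀ {z} → x ~ z → z ≢ y → potential x y z ≡ 0
    potential-beyond {z} f z≢y with z ≟ᶠ x | z ≟ᶠ y
    ... | yes ≡.refl | _       = ⊥-elim (~-irr f)
    ... | no _       | yes z≡y = ⊥-elim (z≢y z≡y)
    ... | no _       | no _    = ≡.refl

  module _ {x y : Fin n} (e : x ~ y) where

    Level : Fin n → Fin n → ℕ
    Level u v = dist T connected u v ℕ.+ (potential x y u ℕ.+ potential y x v)

    private
      level : ∀ {u v k i j} → NBWalk u v k → potential x y u ≡ i → potential y x v ≡ j →
              Level u v ≡ k ℕ.+ (i ℕ.+ j)
      level p eq eq′ = ≡.cong₂ ℕ._+_ (dist≡ p) (≡.cong₂ ℕ._+_ eq eq′)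

    level≡3 : ∀ {u v} → Side x y u → Side y x v → Level u v ≡ 3
    level≡3 centre         centre         =
      level (step e stop ⊣ _) (potential-centre e) (potential-centre (~-sym e))
    level≡3 centre         (beyond f z≢x) =
      level (step e (step f stop) ⊣ (z≢x ∘ ≡.sym , _)) (potential-centre e) (potential-beyond (~-sym e) f z≢x)
    level≡3 (beyond f z≢y) centre         =
      level (step (~-sym f) (step e stop) ⊣ (z≢y , _)) (potential-beyond e f z≢y) (potential-centre (~-sym e))
    level≡3 (beyond f z≢y) (beyond g t≢x) =
      level (step (~-sym f) (step e (step g stop)) ⊣ (z≢y , t≢x ∘ ≡.sym , _))
        (potential-beyond e f z≢y) (potential-beyond (~-sym e) g t≢x)

    level-diagonalˡ : Level x x ≡ 3
    level-diagonalˡ = level (stop ⊣ _) (potential-centre e) (potential-other (~-sym e))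

    level-diagonalʳ : Level y y ≡ 3
    level-diagonalʳ = level (stop ⊣ _) (potential-other e) (potential-centre (~-sym e))

    3≤level : ∀ {u v} → Near x y u → Near y x v → 3 ℕ.≤ Level u v
    3≤level (side p)              (side q)              = ℕ.≤-reflexive (≡.sym (level≡3 p q))
    3≤level (side centre)         other                 = ℕ.≤-reflexive (≡.sym level-diagonalˡ)
    3≤level other                 (side centre)         = ℕ.≤-reflexive (≡.sym level-diagonalʳ)
    3≤level other                 (side (beyond f z≢x)) = ℕ.≤-reflexive (≡.sym
      (level (step f stop ⊣ _) (potential-other e) (potential-beyond (~-sym e) f z≢x)))
    3≤level (side (beyond f z≢y)) other                 = ℕ.≤-reflexive (≡.sym
      (level (step (~-sym f) stop ⊣ _) (potential-beyond e f z≢y) (potential-other (~-sym e))))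
    -- Mass going from y back to x, against the height, is the only slack case; the potentials alone
    -- already contribute 4.
    3≤level other                 other                 = ℕ.≤-trans (ℕ.n≤1+n 3)
      (ℕ.≤-trans (ℕ.≤-reflexive (≡.sym (≡.cong₂ ℕ._+_ (potential-other e) (potential-other (~-sym e)))))
        (ℕ.m≤n+m _ (dist T connected y x)))

-- The curvature of an edge

module OtherEdges (ℝ : CompleteOrderedField) {n} (G : SimpleGraph n) where
  open OrderedField ℝ
  open Sums ℝ
  open SimpleGraph G

  -- others u v f is A_{u∣v}(f), for an f which need not lie in the box.
  others : Fin n → Fin n → (Fin n → Fin n → Carrier) → Carrier
  others u v f = ∑[ z < n ] (f u z when ((u ~? z) ×-dec ¬? (z ≟ᶠ v)))

module CurvatureFormula (ℝ : CompleteOrderedField) {n} {T : SimpleGraph n} (tree : IsTree T)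
                        (w : EdgeFunctions.Weight ℝ T) where
  open OrderedField ℝ
  open Sums ℝ
  open OtherEdges ℝ T
  open SimpleGraph T
  open IsTree tree
  open Curvature ℝ T connected
  open Transport ℝ tree
  open BallDistances tree
  open Weight w using (symmetric; positive)
  open IsCoupling

  W : Fin n → Fin n → Carrier
  W = ⟦ w ⟧

  deg : Fin n → Carrier
  deg = weightedDegree w

  share : Fin n → Fin n → Carrier
  share x y = W x y * deg x ⁻¹

  others-nonNeg : ∀ x y → 0# ≤ others x y W
  others-nonNeg x y = sum-nonNeg _ λ z → when-nonNeg ((x ~? z) ×-dec ¬? (z ≟ᶠ y)) (<⇒≤ ∘ positive ∘ proj₁)

  deg≈ : ∀ {x y} → x ~ y → deg x ≈ W x y + others x y W
  deg≈ {x} {y} e = trans (sum-cong n term) (trans (sum-+ n _ _) (+-congʳ (sum-point n y (W x))))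
    where
    term : ∀ z → W x z when (x ~? z) ≈ W x z when (z ≟ᶠ y) + W x z when ((x ~? z) ×-dec ¬? (z ≟ᶠ y))
    term z with x ~? z | z ≟ᶠ y
    ... | yes _ | yes _      = sym (+-identityʳ _)
    ... | yes _ | no _       = sym (+-identityˡ _)
    ... | no x≁z | yes ≡.refl = ⊥-elim (x≁z e)
    ... | no _  | no _       = sym (+-identityˡ _)

  deg-positive : ∀ {x y} → x ~ y → 0# < deg x
  deg-positive e = <-≤-trans (+-positiveˡ (positive e) (others-nonNeg _ _)) (≤-reflexive (sym (deg≈ e)))

  share*deg : ∀ {x y} → x ~ y → share x y * deg x ≈ W x y
  share*deg e = trans (*-assoc _ _ _) (trans (*-congˡ (⁻¹-inverseˡ (deg-positive e))) (*-identityʳ _))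

  share-positive : ∀ {x y} → x ~ y → 0# < share x y
  share-positive e = *-positive (positive e) (⁻¹-positive (deg-positive e))

  share≤1 : ∀ {x y} → x ~ y → share x y ≤ 1#
  share≤1 e = *-cancelˡ-≤ (deg-positive e)
    (≤-respˡ (trans (sym (share*deg e)) (*-comm _ _))
      (≤-respʳ (sym (*-identityʳ _)) (≤-respʳ (sym (deg≈ e)) (x≤x+y (others-nonNeg _ _)))))

  -- κ x y is 2 (w_xy / d_x + w_xy / d_y − 1).
  κ : Fin n → Fin n → Carrier
  κ x y = (share x y + share y x - 1#) + (share x y + share y x - 1#)

  module _ (α : Carrier) where

    β : Carrier
    β = 1# - α

    β+α : β + α ≈ 1#
    β+α = y-z+z≈y 1# α

    μ≈ : ∀ x z → μ α w x z ≈ α when (z ≟ᶠ x) + (β * share x z) when (x ~? z)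
    μ≈ x z with z ≟ᶠ x | x ~? z
    ... | yes ≡.refl | yes e = ⊥-elim (~-irr e)
    ... | yes _      | no _  = sym (+-identityʳ _)
    ... | no _       | yes _ = trans (*-assoc _ _ _) (sym (+-identityˡ _))
    ... | no _       | no _  = sym (+-identityˡ _)

    μ-centre : ∀ x → μ α w x x ≈ α
    μ-centre x with x ≟ᶠ x
    ... | yes _  = refl
    ... | no x≢x = ⊥-elim (x≢x ≡.refl)

    μ-neighbour : ∀ {x y} → x ~ y → μ α w x y ≈ β * share x y
    μ-neighbour {x} {y} e with y ≟ᶠ x | x ~? y
    ... | yes ≡.refl | _      = ⊥-elim (~-irr e)
    ... | no _       | yes _  = *-assoc _ _ _
    ... | no _       | no x≁y = ⊥-elim (x≁y e)

    μ-support : ∀ {x y u} → ¬ μ α w x u ≈ 0# → Near x y u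
    μ-support {x} {y} {u} μ≉0 with u ≟ᶠ x | x ~? u | u ≟ᶠ y
    ... | yes ≡.refl | _     | _          = side centre
    ... | no _       | yes f | yes ≡.refl = other
    ... | no _       | yes f | no u≢y     = side (beyond f u≢y)
    ... | no _       | no _  | _          = ⊥-elim (μ≉0 refl)

    μ-total : ∀ {x y} → x ~ y → ∑[ z < n ] μ α w x z ≈ 1#
    μ-total {x} e = begin-equality
      ∑[ z < n ] μ α w x z
        ≈⟨ trans (sum-cong n (μ≈ x)) (sum-+ n _ _) ⟩
      ∑[ z < n ] (α when (z ≟ᶠ x)) + ∑[ z < n ] ((β * share x z) when (x ~? z))
        ≈⟨ +-cong (sum-point n x (λ _ → α)) (trans (sum-cong n term) (sum-*ˡ n _ _)) ⟩
      α + β * deg x ⁻¹ * deg x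
        ≈⟨ +-congˡ (trans (*-assoc _ _ _) (trans (*-congˡ (⁻¹-inverseˡ (deg-positive e))) (*-identityʳ β))) ⟩
      α + β
        ≈⟨ trans (+-comm _ _) β+α ⟩
      1# ∎
      where
      open ≤R
      term : ∀ z → (β * share x z) when (x ~? z) ≈ β * deg x ⁻¹ * (W x z when (x ~? z))
      term z = trans (when-cong (x ~? z) λ _ → solve 3 (λ a b c → a :* (b :* c) := a :* c :* b) refl _ _ _)
                     (*-when (x ~? z) _ _)

    potential-sum : ∀ {x y} → x ~ y →
                    ∑[ u < n ] (potential x y u · μ α w x u) ≈ α + 2 · (β * share x y)
    potential-sum {x} {y} e = trans (sum-cong n term) (trans (sum-+ n _ _) (+-cong
      (trans (sum-point n x (μ α w x)) (μ-centre x))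
      (trans (sum-point n y (λ u → 2 · μ α w x u))
        (+-cong (μ-neighbour e) (+-congʳ (μ-neighbour e))))))
      where
      term : ∀ u → potential x y u · μ α w x u ≈ μ α w x u when (u ≟ᶠ x) + (2 · μ α w x u) when (u ≟ᶠ y)
      term u = by-cases (u ≟ᶠ x) (u ≟ᶠ y) (μ α w x u)
        where
        by-cases : (p : Dec (u ≡ x)) (q : Dec (u ≡ y)) → ∀ r →
                   (if does p then 1 else if does q then 2 else 0) · r ≈ r when p + (2 · r) when q
        by-cases (yes ≡.refl) (yes ≡.refl) r = ⊥-elim (~-irr e)
        by-cases (yes _)      (no _)       r = refl
        by-cases (no _)       (yes _)      r = sym (+-identityˡ _)
        by-cases (no _)       (no _)       r = sym (+-identityˡ _)

  module _ {x y : Fin n} (e : x ~ y) (α : Carrier) (β<α : β α < α) (α<1 : α < 1#) where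

    private
      b p q r r′ : Carrier
      b = β α
      -- `p` is the mass of the measure at x on y, and `q` that of the measure at y on x. Both are
      -- below α, so `q` at x and `p` at y form the common part `stay`, and `r`, `r′` are what
      -- remains at the centres.
      p = b * share x y
      q = b * share y x
      r = α - q
      r′ = α - p

      0≤b : 0# ≤ b
      0≤b = +-cancelˡ-≤ α (≤-respˡ (sym (+-identityʳ α)) (≤-respʳ (sym (trans (+-comm _ _) (β+α α))) (<⇒≤ α<1)))

      -- Shares are at most 1, so b s ≤ b < α; this is where `β<α` enters.
      0<α-b*s : ∀ {s} → s ≤ 1# → 0# < α - b * s
      0<α-b*s {s} s≤1 = ≰⇒> λ α-bs≤0 → <⇒≱ β<α (≤-trans
        (≤-respˡ (y-z+z≈y α (b * s)) (≤-respʳ (+-identityˡ _) (+-mono-≤ α-bs≤0 ≤-refl)))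
        (≤-respʳ (*-identityʳ b) (*-monoʳ-≤ 0≤b s≤1)))

      stay : Fin n → Carrier
      stay u = q when (u ≟ᶠ x) + p when (u ≟ᶠ y)

      rest : Carrier → Fin n → Fin n → Fin n → Carrier
      rest t v v′ u = t when (u ≟ᶠ v) + (b * share v u) when ((v ~? u) ×-dec ¬? (u ≟ᶠ v′))

      0≤p : 0# ≤ p
      0≤p = *-nonNeg 0≤b (<⇒≤ (share-positive e))

      0≤q : 0# ≤ q
      0≤q = *-nonNeg 0≤b (<⇒≤ (share-positive (~-sym e)))

      stay-nonNeg : ∀ u → 0# ≤ stay u
      stay-nonNeg u = +-nonNeg (when-nonNeg (u ≟ᶠ x) λ _ → 0≤q) (when-nonNeg (u ≟ᶠ y) λ _ → 0≤p)

      rest-nonNeg : ∀ {t} → 0# ≤ t → ∀ v v′ u → 0# ≤ rest t v v′ u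
      rest-nonNeg 0≤t v v′ u = +-nonNeg (when-nonNeg (u ≟ᶠ v) λ _ → 0≤t)
        (when-nonNeg ((v ~? u) ×-dec ¬? (u ≟ᶠ v′)) λ (f , _) → *-nonNeg 0≤b (<⇒≤ (share-positive f)))

      rest-support : ∀ {t v v′ u} → ¬ rest t v v′ u ≈ 0# → Side v v′ u
      rest-support {t} {v} {v′} {u} ≉0 with u ≟ᶠ v | v ~? u | u ≟ᶠ v′
      ... | yes ≡.refl | _     | _       = centre
      ... | no _       | yes f | no u≢v′ = beyond f u≢v′
      ... | no _       | yes _ | yes _   = ⊥-elim (≉0 (+-identityˡ _))
      ... | no _       | no _  | _       = ⊥-elim (≉0 (+-identityˡ _))

      split : ∀ {v v′ s t} → v ~ v′ → t + s ≈ α → ∀ u →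
              (s when (u ≟ᶠ v) + (b * share v v′) when (u ≟ᶠ v′)) + rest t v v′ u ≈ μ α w v u
      split {v} {v′} {s} {t} f t+s≈α u = trans (by-cases (u ≟ᶠ v) (v ~? u) (u ≟ᶠ v′)) (sym (μ≈ α v u))
        where
        by-cases : (i : Dec (u ≡ v)) (j : Dec (v ~ u)) (k : Dec (u ≡ v′)) →
                   (s when i + (b * share v v′) when k) + (t when i + (b * share v u) when (j ×-dec ¬? k))
                   ≈ α when i + (b * share v u) when j
        by-cases (yes ≡.refl) (yes g) _            = ⊥-elim (~-irr g)
        by-cases (yes ≡.refl) (no _)  (yes ≡.refl) = ⊥-elim (~-irr f)
        by-cases (yes _)      (no _)  (no _)       = trans
          (solve 2 (λ s t → s :+ con 0 :+ (t :+ con 0) := t :+ s :+ con 0) refl s t) (+-congʳ t+s≈α)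
        by-cases (no _)       (yes _) (yes ≡.refl) = trans (+-congˡ (+-identityˡ _)) (+-identityʳ _)
        by-cases (no _)       (yes _) (no _)       = trans (+-congʳ (+-identityˡ _)) (+-identityˡ _)
        by-cases (no _)       (no g)  (yes ≡.refl) = ⊥-elim (g f)
        by-cases (no _)       (no _)  (no _)       = trans (+-congʳ (+-identityˡ _)) (+-identityˡ _)

      splitˡ : ∀ u → stay u + rest r x y u ≈ μ α w x u
      splitˡ = split e (y-z+z≈y α q)

      splitʳ : ∀ u → stay u + rest r′ y x u ≈ μ α w y u
      splitʳ u = trans (+-congʳ (+-comm _ _)) (split (~-sym e) (y-z+z≈y α p) u)

      M : Carrier
      M = ∑[ u < n ] rest r x y u

      total-split : ∀ {t v v′} → (∀ u → stay u + rest t v v′ u ≈ μ α w v u) → v ~ v′ →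
                    ∑[ u < n ] stay u + ∑[ u < n ] rest t v v′ u ≈ 1#
      total-split eq f = trans (sym (sum-+ n _ _)) (trans (sum-cong n eq) (μ-total α f))

      totalʳ : ∑[ u < n ] rest r′ y x u ≈ M
      totalʳ = +-cancelˡ-≈ _ (trans (total-split splitʳ (~-sym e)) (sym (total-split splitˡ e)))

      0<r : 0# < r
      0<r = 0<α-b*s (share≤1 (~-sym e))

      0<r′ : 0# < r′
      0<r′ = 0<α-b*s (share≤1 e)

      0<M : 0# < M
      0<M = <-≤-trans 0<r (≤-trans
        (≤-respˡ (when-true (x ≟ᶠ x) ≡.refl)
          (x≤x+y (when-nonNeg ((x ~? x) ×-dec ¬? (x ≟ᶠ y)) λ (f , _) → ⊥-elim (~-irr f))))
        (term≤sum n (rest-nonNeg (<⇒≤ 0<r) x y) x))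

      π : Fin n → Fin n → Carrier
      π = residual-coupling (rest-nonNeg (<⇒≤ 0<r) x y) (rest-nonNeg (<⇒≤ 0<r′) y x) stay-nonNeg 0<M refl totalʳ

      π-isCoupling : IsCoupling (μ α w x) (μ α w y) π
      π-isCoupling = record
        { nonNeg    = nonNeg π′
        ; marginalˡ = λ u → trans (marginalˡ π′ u) (splitˡ u)
        ; marginalʳ = λ v → trans (marginalʳ π′ v) (splitʳ v)
        }
        where
        π′ = residual-isCoupling (rest-nonNeg (<⇒≤ 0<r) x y) (rest-nonNeg (<⇒≤ 0<r′) y x) stay-nonNeg 0<M refl totalʳ

      stay-support : ∀ u → ¬ stay u ≈ 0# → u ≡ x ⊎ u ≡ y
      stay-support u ≉0 with u ≟ᶠ x | u ≟ᶠ y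
      ... | yes u≡x | _       = inj₁ u≡x
      ... | no _    | yes u≡y = inj₂ u≡y
      ... | no _    | no _    = ⊥-elim (≉0 (+-identityˡ _))

      tight : ∀ u v → ¬ π u v ≈ 0# → Level e u v ≡ 3
      tight u v ≉0
        with residual-support (rest-nonNeg (<⇒≤ 0<r) x y) (rest-nonNeg (<⇒≤ 0<r′) y x) stay-nonNeg 0<M refl totalʳ ≉0
      ... | inj₂ (≉0ˡ , ≉0ʳ) = level≡3 e (rest-support ≉0ˡ) (rest-support ≉0ʳ)
      ... | inj₁ (≡.refl , ≉0′) with stay-support u ≉0′
      ...   | inj₁ ≡.refl = level-diagonalˡ e
      ...   | inj₂ ≡.refl = level-diagonalʳ e

      dual : Carrier
      dual = (α + 2 · p) + (α + 2 · q)

      dual≈ : ∑[ u < n ] (potential x y u · μ α w x u) + ∑[ v < n ] (potential y x v · μ α w y v) ≈ dual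
      dual≈ = +-cong (potential-sum α e) (potential-sum α (~-sym e))

      3·total : 3 · ∑[ u < n ] μ α w x u ≈ 3 · 1#
      3·total = +-cong t (+-cong t (+-congʳ t))
        where t = μ-total α e

      c : Carrier
      c = cost π

      c+dual : c + dual ≈ 3 · 1#
      c+dual = trans (+-congˡ (sym dual≈)) (trans (dual-tight π-isCoupling (potential x y) (potential y x) 3 tight) 3·total)

      c-isW₁ : IsW₁ (μ α w x) (μ α w y) c
      c-isW₁ = lower , λ b′ lb → lb c (π , π-isCoupling , refl)
        where
        lower : ∀ a → (∃ λ π′ → IsCoupling (μ α w x) (μ α w y) π′ × a ≈ cost π′) → c ≤ a
        lower a (π′ , coupling , a≈) = ≤-respʳ (sym a≈) (+-cancelˡ-≤ dual
          (≤-respˡ (trans 3·total (trans (sym c+dual) (+-comm _ _)))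
            (≤-respʳ (trans (+-congˡ dual≈) (+-comm _ _))
              (dual-bound coupling (potential x y) (potential y x) 3 λ u v ≉0 →
                3≤level e (μ-support α (coupling-supportˡ coupling ≉0))
                          (μ-support α (coupling-supportʳ coupling ≉0))))))

      bκ+c≈1 : b * κ x y + c ≈ 1#
      -- Adding `2 · b` absorbs the two subtractions of 1 in `κ x y`, and adding `dual` turns the
      -- cost into 3, so only semiring identities remain.
      bκ+c≈1 = +-cancelˡ-≈ (dual + 2 · b) (begin-equality
        dual + 2 · b + (b * κ x y + c)
          ≈⟨ solve 4 (λ D b j c → D :+ (b :+ (b :+ con 0)) :+ (b :* (j :+ j) :+ c)
                               := b :* ((j :+ con 1) :+ (j :+ con 1)) :+ (c :+ D)) refl dual b _ c ⟩
        b * ((share x y + share y x - 1# + 1#) + (share x y + share y x - 1# + 1#)) + (c + dual)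
          ≈⟨ +-cong (*-congˡ (+-cong j+1 j+1)) c+dual ⟩
        b * ((share x y + share y x) + (share x y + share y x)) + 3 · 1#
          ≈⟨ solve 3 (λ b s t → b :* ((s :+ t) :+ (s :+ t)) :+ (con 1 :+ (con 1 :+ (con 1 :+ con 0)))
                              := (con 1 :+ (con 1 :+ con 0)) :+ (b :* s :+ b :* s :+ (b :* t :+ b :* t)) :+ con 1) refl b _ _ ⟩
        2 · 1# + (p + p + (q + q)) + 1#
          ≈⟨ +-cong (+-congʳ (+-cong (sym (β+α α)) (+-congʳ (sym (β+α α))))) refl ⟩
        ((b + α) + ((b + α) + 0#)) + (p + p + (q + q)) + 1#
          ≈⟨ +-congʳ (solve 4 (λ b a p q → ((b :+ a) :+ ((b :+ a) :+ con 0)) :+ (p :+ p :+ (q :+ q))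
              := ((a :+ (p :+ (p :+ con 0))) :+ (a :+ (q :+ (q :+ con 0)))) :+ (b :+ (b :+ con 0))) refl b α p q) ⟩
        dual + 2 · b + 1# ∎)
        where
        open ≤R
        j+1 : share x y + share y x - 1# + 1# ≈ share x y + share y x
        j+1 = y-z+z≈y _ 1#

    -- The curvature is exactly linear in 1 - α in this range, so the limit defining `IsκLLY` is
    -- that of a constant.
    κ-isκ : Isκ α w x y (b * κ x y)
    κ-isκ = c , c-isW₁ , x+z≈y⇒x≈y-z bκ+c≈1

    isκ-unique : ∀ {k} → Isκ α w x y k → k ≈ b * κ x y
    isκ-unique (c′ , isW₁ , k≈) = trans k≈ (trans
      (+-congˡ (-‿cong (infimum-unique isW₁ c-isW₁))) (sym (x+z≈y⇒x≈y-z bκ+c≈1)))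

-- From nonnegative curvature to the product inequality

module Midpoints (ℝ : CompleteOrderedField) where
  open OrderedField ℝ

  neg-mono-≤ : ∀ {x y} → x ≤ y → - y ≤ - x
  neg-mono-≤ {x} {y} x≤y = +-cancelˡ-≤ x (≤-respʳ (sym (-‿inverseʳ x)) (≤-respʳ (-‿inverseʳ y)
    (+-mono-≤ x≤y ≤-refl)))

  neg-positive : ∀ {x} → x < 0# → 0# < - x
  neg-positive {x} x<0 = ≰⇒> λ -x≤0 → <⇒≱ x<0
    (≤-respˡ (-‿inverseʳ x) (≤-respʳ (+-identityʳ x) (+-monoʳ-≤ x -x≤0)))

  x-y<x : ∀ {x y} → 0# < y → x - y < x
  x-y<x {x} {y} 0<y = ≰⇒> λ x≤x-y → <⇒≱ 0<y (+-cancelˡ-≤ x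
    (≤-respʳ (trans (y-z+z≈y x y) (sym (+-identityʳ x))) (+-mono-≤ x≤x-y ≤-refl)))

  0<2 : 0# < 1# + 1#
  0<2 = +-positiveˡ 0<1 0≤1

  ½ : Carrier
  ½ = (1# + 1#) ⁻¹

  ½-double : ∀ x → ½ * x + ½ * x ≈ x
  ½-double x = trans (solve 2 (λ h x → h :* x :+ h :* x := h :* ((con 1 :+ con 1) :* x)) refl ½ x)
                     (⁻¹-cancelˡ x 0<2)

  dense : ∀ {x y} → x < y → ∃ λ z → x < z × z < y
  dense {x} {y} x<y = ½ * (x + y) ,
    ≰⇒> (λ m≤x → <⇒≱ x<y (+-cancelˡ-≤ x (≤-respˡ (½-double (x + y)) (+-mono-≤ m≤x m≤x)))) ,
    ≰⇒> (λ y≤m → <⇒≱ x<y (+-cancelˡ-≤ y (≤-respʳ (trans (½-double (x + y)) (+-comm x y)) (+-mono-≤ y≤m y≤m))))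

module AdmissibleWeights (ℝ : CompleteOrderedField) {n} {T : SimpleGraph n} (tree : IsTree T)
                         (w : EdgeFunctions.Weight ℝ T) where
  open OrderedField ℝ
  open Sums ℝ
  open Midpoints ℝ
  open OtherEdges ℝ T
  open SimpleGraph T
  open IsTree tree
  open Curvature ℝ T connected
  open CurvatureFormula ℝ tree w
  open Max totalOrder using (⊔-cong; x≤x⊔y; x≤y⊔x; ⊔-sel)
  open Weight w using (symmetric; positive)

  private
    ½+½ : ½ + ½ ≈ 1#
    ½+½ = trans (sym (+-cong (*-identityʳ ½) (*-identityʳ ½))) (½-double 1#)

    β<α : ∀ {α} → 1# - ½ < α → β α < α
    β<α {α} ½<α = ≰⇒> λ α≤β → <⇒≱ ½<α (≤-respʳ (x+z≈y⇒x≈y-z ½+½)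
      (+-cancelˡ-≤ ½ (≤-respʳ (trans (β+α α) (sym ½+½)) (+-mono-≤
        (≤-trans (≤-reflexive (x+z≈y⇒x≈y-z ½+½)) (≤-trans (<⇒≤ ½<α) α≤β)) ≤-refl))))

    0<β : ∀ {α} → α < 1# → 0# < β α
    0<β {α} α<1 = ≰⇒> λ β≤0 → <⇒≱ α<1
      (≤-respˡ (trans (+-comm _ _) (β+α α)) (≤-respʳ (+-identityʳ α) (+-monoʳ-≤ α β≤0)))

    ratio : ∀ {α k K} → α < 1# → k ≈ β α * K → k / β α ≈ K
    ratio α<1 k≈ = trans (*-comm _ _) (trans (*-congˡ k≈) (⁻¹-cancelˡ _ (0<β α<1)))

  module _ {x y : Fin n} (e : x ~ y) where

    κ-isκLLY : ∀ {l} → κ x y ≈ l → IsκLLY w x y l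
    -- δ = 1/2 serves every ε, since the quotient already equals its limit for α > 1/2.
    κ-isκLLY {l} κ≈l ε 0<ε = ½ , ⁻¹-positive 0<2 , λ α _ ½<α α<1 →
      β α * κ x y , κ-isκ e α (β<α ½<α) α<1 ,
      ≤-<-trans (≤-reflexive (abs≈0 (trans (+-congʳ (trans (ratio α<1 refl) κ≈l)) (-‿inverseʳ l)))) 0<ε
      where
      abs≈0 : ∀ {t} → t ≈ 0# → ∣ t ∣ ≈ 0#
      abs≈0 {t} t≈0 = trans (⊔-cong t≈0 (trans (-‿cong t≈0)
        (trans (sym (+-identityˡ _)) (-‿inverseʳ 0#)))) ([ id , id ]′ (⊔-sel 0# 0#))

    -- If κ < 0, take ε = -κ and an α beyond both 1/2 and 1 - δ. The quotient there is κ itself, yet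
    -- its distance to l is at least l - κ ≥ -κ.
    isκLLY⇒0≤κ : ∀ {l} → IsκLLY w x y l → 0# ≤ l → 0# ≤ κ x y
    isκLLY⇒0≤κ {l} isκLLY 0≤l = ≮⇒≥ λ κ<0 → absurd κ<0 (isκLLY (- κ x y) (neg-positive κ<0))
      where
      absurd : κ x y < 0# → ¬ (∃ λ δ → 0# < δ × (∀ α → 0# ≤ α → 1# - δ < α → α < 1# →
                 ∃ λ k → Isκ α w x y k × ∣ k / (1# - α) - l ∣ < - κ x y))
      absurd κ<0 (δ , 0<δ , close) = <⇒≱ close-enough (≤-trans (neg-mono-≤ (≤-respʳ (y-z+z≈y _ l) (x≤x+y 0≤l)))
        (≤-trans (≤-reflexive (-‿cong (+-congʳ (sym k/β≈κ)))) (x≤y⊔x _ _)))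
        where
        m<1 : 1# - δ ⊔ (1# - ½) < 1#
        m<1 with ⊔-sel (1# - δ) (1# - ½)
        ... | inj₁ eq = ≤-<-trans (≤-reflexive eq) (x-y<x 0<δ)
        ... | inj₂ eq = ≤-<-trans (≤-reflexive eq) (x-y<x (⁻¹-positive 0<2))
        α = proj₁ (dense m<1)
        m<α = proj₁ (proj₂ (dense m<1))
        α<1 = proj₂ (proj₂ (dense m<1))
        1-δ<α : 1# - δ < α
        1-δ<α = ≤-<-trans (x≤x⊔y _ _) m<α
        ½<α : 1# - ½ < α
        ½<α = ≤-<-trans (x≤y⊔x _ _) m<α
        0≤α : 0# ≤ α
        0≤α = ≤-trans (≤-trans (<⇒≤ (⁻¹-positive 0<2)) (≤-reflexive (x+z≈y⇒x≈y-z ½+½))) (<⇒≤ ½<α)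
        kκ = close α 0≤α 1-δ<α α<1
        k/β≈κ : proj₁ kκ / β α ≈ κ x y
        k/β≈κ = ratio α<1 (isκ-unique e α (β<α ½<α) α<1 (proj₁ (proj₂ kκ)))
        close-enough : ∣ proj₁ kκ / β α - l ∣ < - κ x y
        close-enough = proj₂ (proj₂ kκ)

    private
      a b D p+q : Carrier
      a = others x y W
      b = others y x W
      D = deg x * deg y
      p+q = share x y + share y x

      0<D : 0# < D
      0<D = *-positive (deg-positive e) (deg-positive (~-sym e))

      -- With d_x = w + a and d_y = w + b this is w(w + b) + w(w + a) + ab = (w + a)(w + b) + w².
      -- Hence the sum of the shares minus 1 has the sign of w² - ab.
      balance : D * p+q + a * b ≈ D + W x y * W x y
      balance = begin-equality
        D * p+q + a * b
          ≈⟨ +-congʳ (solve 4 (λ d d′ s s′ → d :* d′ :* (s :+ s′) := s :* d :* d′ :+ s′ :* d′ :* d) refl _ _ _ _) ⟩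
        share x y * deg x * deg y + share y x * deg y * deg x + a * b
          ≈⟨ +-congʳ (+-cong (*-cong (share*deg e) (trans (deg≈ (~-sym e)) (+-congʳ W≈)))
                            (*-cong (trans (share*deg (~-sym e)) W≈) (deg≈ e))) ⟩
        W x y * (W x y + b) + W x y * (W x y + a) + a * b
          ≈⟨ solve 3 (λ w a b → w :* (w :+ b) :+ w :* (w :+ a) :+ a :* b
                             := (w :+ a) :* (w :+ b) :+ w :* w) refl _ a b ⟩
        (W x y + a) * (W x y + b) + W x y * W x y
          ≈⟨ +-congʳ (sym (*-cong (deg≈ e) (trans (deg≈ (~-sym e)) (+-congʳ W≈)))) ⟩
        D + W x y * W x y ∎
        where
        open ≤R
        W≈ : W y x ≈ W x y
        W≈ = symmetric (~-sym e)

      κ≈0 : p+q ≈ 1# → κ x y ≈ 0#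
      κ≈0 eq = trans (+-cong j j) (+-identityˡ 0#)
        where
        j : p+q - 1# ≈ 0#
        j = trans (+-congʳ eq) (-‿inverseʳ 1#)

    0≤κ⇒product≤ : 0# ≤ κ x y → a * b ≤ W x y * W x y
    0≤κ⇒product≤ 0≤κ = +-cancelˡ-≤ D (≤-respʳ balance (≤-respˡ (+-congʳ (*-identityʳ D))
      (+-mono-≤ (*-monoʳ-≤ (<⇒≤ 0<D) 1≤p+q) ≤-refl)))
      where
      0≤j : 0# ≤ p+q - 1#
      0≤j with total 0# (p+q - 1#)
      ... | inj₁ 0≤j = 0≤j
      ... | inj₂ j≤0 = ≤-trans 0≤κ (≤-respʳ (+-identityʳ _) (+-monoʳ-≤ _ j≤0))
      1≤p+q : 1# ≤ p+q
      1≤p+q = ≤-respˡ (+-identityʳ 1#) (≤-respʳ (trans (+-comm _ _) (y-z+z≈y _ 1#)) (+-monoʳ-≤ 1# 0≤j))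

    product≤⇒0≤κ : a * b ≤ W x y * W x y → 0# ≤ κ x y
    product≤⇒0≤κ ab≤ww = +-nonNeg 0≤j 0≤j
      where
      1≤p+q : 1# ≤ p+q
      1≤p+q = *-cancelˡ-≤ 0<D (≤-respˡ (sym (*-identityʳ D)) (+-cancelˡ-≤ (a * b)
        (≤-respˡ (+-comm _ _) (≤-respʳ (trans (sym balance) (+-comm _ _)) (+-monoʳ-≤ D ab≤ww)))))
      0≤j : 0# ≤ p+q - 1#
      0≤j = ≤-respˡ (-‿inverseʳ 1#) (+-mono-≤ 1≤p+q ≤-refl)

    product≈⇒flat : a * b ≈ W x y * W x y → IsκLLY w x y 0#
    product≈⇒flat ab≈ww = κ-isκLLY (κ≈0 (*-cancelˡ-≈ 0<D (trans
      (+-cancelˡ-≈ (a * b) (trans (+-comm _ _) (trans balance (trans (+-congˡ (sym ab≈ww)) (+-comm _ _)))))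
      (sym (*-identityʳ D)))))

  product≤⇒admissible : (∀ {x y} → x ~ y → others x y W * others y x W ≤ W x y * W x y) → Admissible w
  product≤⇒admissible p e = κ _ _ , κ-isκLLY e refl , product≤⇒0≤κ e (p e)

  admissible⇒product≤ : Admissible w → ∀ {x y} → x ~ y → others x y W * others y x W ≤ W x y * W x y
  admissible⇒product≤ adm e with adm e
  ... | l , isκLLY , 0≤l = 0≤κ⇒product≤ e (isκLLY⇒0≤κ e isκLLY 0≤l)

-- A feasible weight on a finite tree

bounded : ∀ {n} (f : Fin n → ℕ) → ∃ λ b → ∀ i → f i ℕ.≤ b
bounded {zero}  f = 0 , λ ()
bounded {suc n} f with bounded (f ∘ suc)
... | b , f≤b = f zero ℕ.⊔ b , λ where
  zero    → ℕ.m≤m⊔n _ _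
  (suc i) → ℕ.≤-trans (f≤b i) (ℕ.m≤n⊔m _ _)

-- k ↦ N^(Q − k²) decays so fast that the factor N² is absorbed.
module GaussianWeights (N Q : ℕ) .{{_ : ℕ.NonZero N}} where

  g : ℕ → ℕ
  g k = N ℕ.^ (Q ℕ.∸ k ℕ.* k)

  1≤g : ∀ k → 1 ℕ.≤ g k
  1≤g k = ℕ.m^n>0 N (Q ℕ.∸ k ℕ.* k)

  g-anti : ∀ {k l} → k ℕ.≤ l → g l ℕ.≤ g k
  g-anti k≤l = ℕ.^-monoʳ-≤ N (ℕ.∸-monoʳ-≤ Q (ℕ.*-mono-≤ k≤l k≤l))

  -- k² + (k + 2)² = 2(k + 1)² + 2, and the final 2 pays for N². The hypothesis keeps the truncated
  -- subtractions exact; all exponents are rewritten in terms of the excess `t`.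
  g-concave : ∀ k → (2 ℕ.+ k) ℕ.* (2 ℕ.+ k) ℕ.≤ Q → (N ℕ.* g k) ℕ.* (N ℕ.* g (2 ℕ.+ k)) ≡ g (1 ℕ.+ k) ℕ.* g (1 ℕ.+ k)
  g-concave k ≤Q = begin
    (N ℕ.* g k) ℕ.* (N ℕ.* g (2 ℕ.+ k))
      ≡⟨ ℕ.^-distribˡ-+-* N (suc (Q ℕ.∸ k ℕ.* k)) (suc t) ⟨
    N ℕ.^ (suc (Q ℕ.∸ k ℕ.* k) ℕ.+ suc t)
      ≡⟨ ≡.cong (λ i → N ℕ.^ (suc i ℕ.+ suc t)) (exponent (k ℕ.* k)
           (solve 2 (λ k t → (con 2 :+ k) :* (con 2 :+ k) :+ t := con 4 :* k :+ con 4 :+ t :+ k :* k) ≡.refl k t)) ⟩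
    N ℕ.^ (suc (4 ℕ.* k ℕ.+ 4 ℕ.+ t) ℕ.+ suc t)
      ≡⟨ ≡.cong (N ℕ.^_) (solve 2 (λ k t → con 1 :+ (con 4 :* k :+ con 4 :+ t) :+ (con 1 :+ t)
           := (con 2 :* k :+ con 3 :+ t) :+ (con 2 :* k :+ con 3 :+ t)) ≡.refl k t) ⟩
    N ℕ.^ ((2 ℕ.* k ℕ.+ 3 ℕ.+ t) ℕ.+ (2 ℕ.* k ℕ.+ 3 ℕ.+ t))
      ≡⟨ ≡.cong (λ i → N ℕ.^ (i ℕ.+ i)) (exponent ((1 ℕ.+ k) ℕ.* (1 ℕ.+ k))
           (solve 2 (λ k t → (con 2 :+ k) :* (con 2 :+ k) :+ t
             := con 2 :* k :+ con 3 :+ t :+ (con 1 :+ k) :* (con 1 :+ k)) ≡.refl k t)) ⟨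
    N ℕ.^ ((Q ℕ.∸ (1 ℕ.+ k) ℕ.* (1 ℕ.+ k)) ℕ.+ (Q ℕ.∸ (1 ℕ.+ k) ℕ.* (1 ℕ.+ k)))
      ≡⟨ ℕ.^-distribˡ-+-* N (Q ℕ.∸ (1 ℕ.+ k) ℕ.* (1 ℕ.+ k)) _ ⟩
    g (1 ℕ.+ k) ℕ.* g (1 ℕ.+ k) ∎
    where
    open ≡.≡-Reasoning
    open +-*-Solver
    t = Q ℕ.∸ (2 ℕ.+ k) ℕ.* (2 ℕ.+ k)
    exponent : ∀ s {i} → (2 ℕ.+ k) ℕ.* (2 ℕ.+ k) ℕ.+ t ≡ i ℕ.+ s → Q ℕ.∸ s ≡ i
    exponent s {i} eq = ≡.trans (≡.cong (ℕ._∸ s) (≡.trans (≡.sym (ℕ.m+[n∸m]≡n ≤Q)) eq)) (ℕ.m+n∸n≡m i s)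

module FeasibleBoxes (ℝ : CompleteOrderedField) {n} {T : SimpleGraph n} (tree : IsTree T) (edge : HasEdge T) where
  open OrderedField ℝ
  open Sums ℝ
  open OtherEdges ℝ T
  open SimpleGraph T
  open IsTree tree
  open EdgeFunctions ℝ T
  open Transport ℝ tree using (·-mono-≤)
  open TreeWalks tree
  open MonoidMult +-monoid using () renaming (×-assocˡ to ·-assocˡ)
  open SemiringMult semiring using () renaming (×1-homo-* to ·1-homo-*)

  -- On the box this is F b ≤ b, squared so that no root appears.
  Feasible : Box → Set
  Feasible b = ∀ x y → x ~ y → A x y b * A y x b ≤ value b x y * value b x y

  private
    r : Fin n
    r = proj₁ edge
    open Rooted r

    instance
      n≢0 : ℕ.NonZero n
      n≢0 = nonZero r
        where
        nonZero : ∀ {n} → Fin n → ℕ.NonZero n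
        nonZero {suc n} _ = _

    -- In `g-concave` the number `2 + k` will be `suc (depth v)` for the deeper end v of an edge, so
    -- this bound prevents truncation on every edge.
    Q : ℕ
    Q = proj₁ (bounded λ x → suc (depth x) ℕ.* suc (depth x))

    open GaussianWeights n Q

    edgeDepth : Fin n → Fin n → ℕ
    edgeDepth x y = depth x ℕ.⊔ depth y

    box : Box
    box = record
      { value     = λ x y → g (edgeDepth x y) · 1#
      ; symmetric = λ {x} {y} _ → reflexive (≡.cong (λ k → g k · 1#) (ℕ.⊔-comm (depth x) (depth y)))
      ; 1≤value   = λ {x} {y} _ → ≤-respˡ (+-identityʳ 1#) (·-mono-≤ 0≤1 (1≤g (edgeDepth x y)))
      }

    -- The number of vertices is a crude bound for the number of summands, whence the base n of the
    -- Gaussian weights.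
    others≤ : ∀ u v k → (∀ z → u ~ z → z ≢ v → k ℕ.≤ edgeDepth u z) → A u v box ≤ (n ℕ.* g k) · 1#
    others≤ u v k k≤ = ≤-trans (sum≤· n term) (≤-reflexive (·-assocˡ 1# n (g k)))
      where
      term : ∀ z → value box u z when ((u ~? z) ×-dec ¬? (z ≟ᶠ v)) ≤ g k · 1#
      term z with u ~? z | z ≟ᶠ v
      ... | yes e | no z≢v = ·-mono-≤ 0≤1 (g-anti (k≤ z e z≢v))
      ... | yes _ | yes _  = ·-mono-≤ {l = g k} 0≤1 z≤n
      ... | no _  | _      = ·-mono-≤ {l = g k} 0≤1 z≤n

    -- With k the depth of `u`, the other edges at `u` have depth at least k. By `parent-unique` the
    -- other edges at `v` all lead to children and have depth at least k + 2. The edge itself has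
    -- depth k + 1, so `g-concave` applies.
    feasible-down : ∀ {u v} → u ~ v → depth v ≡ suc (depth u) →
                    A u v box * A v u box ≤ value box u v * value box u v
    feasible-down {u} {v} e eq = begin
      A u v box * A v u box
        ≤⟨ *-mono-≤ (A-nonNeg u v box) (A-nonNeg v u box) (others≤ u v k λ z _ _ → ℕ.m≤m⊔n _ _) (others≤ v u (2 ℕ.+ k) child) ⟩
      ((n ℕ.* g k) · 1#) * ((n ℕ.* g (2 ℕ.+ k)) · 1#)
        ≈⟨ ·1-homo-* (n ℕ.* g k) (n ℕ.* g (2 ℕ.+ k)) ⟨
      ((n ℕ.* g k) ℕ.* (n ℕ.* g (2 ℕ.+ k))) · 1#
        ≡⟨ ≡.cong (_· 1#) (g-concave k ≤Q) ⟩
      (g (1 ℕ.+ k) ℕ.* g (1 ℕ.+ k)) · 1#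
        ≈⟨ ·1-homo-* (g (1 ℕ.+ k)) (g (1 ℕ.+ k)) ⟩
      (g (1 ℕ.+ k) · 1#) * (g (1 ℕ.+ k) · 1#)
        ≡⟨ ≡.cong (λ i → (g i · 1#) * (g i · 1#)) edgeDepth≡ ⟨
      value box u v * value box u v ∎
      where
      open ≤R
      k = depth u
      edgeDepth≡ : edgeDepth u v ≡ suc k
      edgeDepth≡ = ≡.trans (≡.cong (depth u ℕ.⊔_) eq) (ℕ.m≤n⇒m⊔n≡n (ℕ.n≤1+n k))
      ≤Q : (2 ℕ.+ k) ℕ.* (2 ℕ.+ k) ℕ.≤ Q
      ≤Q = ≡.subst (λ i → suc i ℕ.* suc i ℕ.≤ Q) eq (proj₂ (bounded λ x → suc (depth x) ℕ.* suc (depth x)) v)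
      child : ∀ z → v ~ z → z ≢ u → 2 ℕ.+ k ℕ.≤ edgeDepth v z
      child z f z≢u with depth-neighbour f
      ... | inj₁ eq′ = ⊥-elim (z≢u (parent-unique f (~-sym e) eq′ eq))
      ... | inj₂ eq′ = ℕ.≤-trans (ℕ.≤-reflexive (≡.sym (≡.trans eq′ (≡.cong suc eq)))) (ℕ.m≤n⊔m (depth v) _)

  feasible-exists : ∃ Feasible
  feasible-exists = box , λ _ _ → feasible
    where
    feasible : ∀ {x y} → x ~ y → A x y box * A y x box ≤ value box x y * value box x y
    feasible {x} {y} e with depth-neighbour e
    ... | inj₂ eq = feasible-down e eq
    ... | inj₁ eq = ≤-respˡ (*-comm _ _) (≤-respʳ (*-cong v≈ v≈) (feasible-down (~-sym e) eq))
      where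
      v≈ : value box y x ≈ value box x y
      v≈ = Box.symmetric box (~-sym e)

-- Comparing edge sums

module EdgeLemmas (ℝ : CompleteOrderedField) {n} (T : SimpleGraph n) where
  open OrderedField ℝ
  open Sums ℝ
  open OtherEdges ℝ T
  open SimpleGraph T
  open EdgeFunctions ℝ T

  other? : ∀ x y → Dec (∃ λ z → x ~ z × z ≢ y)
  other? x y = any? λ z → (x ~? z) ×-dec ¬? (z ≟ᶠ y)

  others-mono-≤ : ∀ {f g} → f ≤ᴱ g → ∀ u v → others u v f ≤ others u v g
  others-mono-≤ f≤g u v = sum-mono-≤ n λ z → when-mono-≤ ((u ~? z) ×-dec ¬? (z ≟ᶠ v)) (f≤g ∘ proj₁)

  others-*ˡ : ∀ c f u v → others u v (λ x y → c * f x y) ≈ c * others u v f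
  others-*ˡ c f u v = trans (sum-cong n λ z → *-when ((u ~? z) ×-dec ¬? (z ≟ᶠ v)) c (f u z)) (sum-*ˡ n c _)

  -- Both sides of the product inequality are homogeneous of degree two, so the inequality survives
  -- rescaling of a weight.
  others-product-*ˡ : ∀ c f u v → others u v (λ x y → c * f x y) * others v u (λ x y → c * f x y)
                      ≈ c * c * (others u v f * others v u f)
  others-product-*ˡ c f u v = trans (*-cong (others-*ˡ c f u v) (others-*ˡ c f v u))
    (solve 3 (λ c a b → c :* a :* (c :* b) := c :* c :* (a :* b)) refl c _ _)

  others-empty : ∀ f {u v} → ¬ (∃ λ z → u ~ z × z ≢ v) → others u v f ≈ 0#
  others-empty f {u} {v} none = sum-zero n λ z → when-false ((u ~? z) ×-dec ¬? (z ≟ᶠ v)) λ p → none (z , p)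

  others-tight : ∀ {f g u v} → f ≤ᴱ g → others u v g ≤ others u v f → ∀ {z} → u ~ z → z ≢ v → g u z ≤ f u z
  others-tight {u = u} {v} f≤g p {z} e z≢v =
    ≤-respˡ (when-true (P? z) (e , z≢v)) (≤-respʳ (when-true (P? z) (e , z≢v))
      (sum-tight n (λ z → when-mono-≤ (P? z) (f≤g ∘ proj₁)) p z))
    where
    P? : ∀ z → Dec (u ~ z × z ≢ v)
    P? z = (u ~? z) ×-dec ¬? (z ≟ᶠ v)

  A-empty : ∀ b {u v} → ¬ (∃ λ z → u ~ z × z ≢ v) → A u v b * A v u b ≈ 0#
  A-empty b none = trans (*-congʳ (others-empty (value b) none)) (zeroˡ _)

  1≤A : ∀ b {u v z} → u ~ z → z ≢ v → 1# ≤ A u v b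
  1≤A b {u} {v} {z} e z≢v = ≤-trans (Box.1≤value b e)
    (≤-respˡ (when-true (P? z) (e , z≢v)) (term≤sum n (λ z → when-nonNeg (P? z) (≤-trans 0≤1 ∘ Box.1≤value b ∘ proj₁)) z))
    where
    P? : ∀ z → Dec (u ~ z × z ≢ v)
    P? z = (u ~? z) ×-dec ¬? (z ≟ᶠ v)

  -- Equality on one edge spreads to all edges beyond it.
  squeeze : ∀ {f g u v} → f ≤ᴱ g → (∀ {x y} → x ~ y → 0# ≤ f x y) → 0# < others u v f * others v u f →
            others u v g * others v u g ≤ others u v f * others v u f →
            ∀ {z} → v ~ z → z ≢ u → g v z ≤ f v z
  squeeze {f} {g} {u} {v} f≤g 0≤f 0<AA AA≤ = others-tight f≤g
    (*-squeeze (nonNeg v u) (nonNeg u v) (others-mono-≤ f≤g v u) (others-mono-≤ f≤g u v)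
      (<-≤-trans 0<AA (≤-reflexive (*-comm _ _)))
      (≤-respˡ (*-comm _ _) (≤-respʳ (*-comm _ _) AA≤)))
    where
    nonNeg : ∀ x y → 0# ≤ others x y f
    nonNeg x y = sum-nonNeg _ λ z → when-nonNeg ((x ~? z) ×-dec ¬? (z ≟ᶠ y)) (0≤f ∘ proj₁)

  edge-maximum : HasEdge T → (f : Fin n → Fin n → Carrier) →
                 ∃₂ λ u v → u ~ v × (∀ {x y} → x ~ y → f x y ≤ f u v)
  edge-maximum (x₀ , y₀ , e₀) f = proj₁ m , proj₂ m , m-edge , λ {x} {y} e →
    All.lookup (f[xs]≤f[argmax] {f = f′} (x₀ , y₀) edges)
      (∈-filter⁺ edge? (∈-cartesianProduct⁺ (∈-allFin x) (∈-allFin y)) e)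
    where
    open Extrema totalOrder
    f′ : Fin n × Fin n → Carrier
    f′ (x , y) = f x y
    Edge : Pred (Fin n × Fin n) 0ℓ
    Edge (x , y) = x ~ y
    edge? : Decidable Edge
    edge? (x , y) = x ~? y
    edges : List (Fin n × Fin n)
    edges = filter edge? (cartesianProduct (allFin n) (allFin n))
    m = argmax f′ (x₀ , y₀) edges
    m-edge : Edge m
    m-edge = argmax-all f′ {P = Edge} e₀ (all-filter edge? (cartesianProduct (allFin n) (allFin n)))

-- Existence and uniqueness of the fixed point

module FixedPoints (ℝ : CompleteOrderedField) {n} {T : SimpleGraph n} (tree : IsTree T) (edge : HasEdge T) where
  open OrderedField ℝ
  open Sums ℝ
  open OtherEdges ℝ T
  open EdgeLemmas ℝ T
  open SimpleGraph T
  open IsTree tree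
  open EdgeFunctions ℝ T
  open FeasibleBoxes ℝ tree edge
  open TreeWalks tree
  open Max totalOrder using (⊔-sel; x≤x⊔y; x≤y⊔x; ⊔-lub)

  value≥0 : ∀ b {x y} → x ~ y → 0# ≤ value b x y
  value≥0 b e = ≤-trans 0≤1 (Box.1≤value b e)

  value>0 : ∀ b {x y} → x ~ y → 0# < value b x y
  value>0 b e = <-≤-trans 0<1 (Box.1≤value b e)

  product≤F² : ∀ b u v → A u v b * A v u b ≤ value (F b) u v * value (F b) u v
  product≤F² b u v = ≤-respˡ (√-square _) (square-mono-≤ (√-nonNeg _) (x≤y⊔x _ _))

  F≤ : ∀ b {u v r} → 1# ≤ r → A u v b * A v u b ≤ r * r → value (F b) u v ≤ r
  F≤ b 1≤r AA≤rr = ⊔-lub 1≤r (square-cancel-≤ (√-nonNeg _) (≤-trans 0≤1 1≤r) (≤-respˡ (sym (√-square _)) AA≤rr))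

  F-cases : ∀ b u v → value (F b) u v ≈ 1# ⊎ value (F b) u v * value (F b) u v ≈ A u v b * A v u b
  F-cases b u v with ⊔-sel 1# (√ (*-nonNeg (A-nonNeg u v b) (A-nonNeg v u b)))
  ... | inj₁ eq = inj₁ eq
  ... | inj₂ eq = inj₂ (trans (*-cong eq eq) (√-square _))

  product-mono-≤ : ∀ {b b′} → value b ≤ᴱ value b′ → ∀ u v → A u v b * A v u b ≤ A u v b′ * A v u b′
  product-mono-≤ {b} b≤b′ u v =
    *-mono-≤ (A-nonNeg u v b) (A-nonNeg v u b) (others-mono-≤ b≤b′ u v) (others-mono-≤ b≤b′ v u)

  private
    FeasibleValue : Fin n → Fin n → Pred Carrier 0ℓ
    FeasibleValue x y r = ∃ λ b → Feasible b × r ≈ value b x y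

    least-value : ∀ {x y} → x ~ y → ∃ (IsInfimum _≤_ (FeasibleValue x y))
    least-value e = infimum _ (_ , proj₁ feasible-exists , proj₂ feasible-exists , refl)
      (1# , λ _ (b , _ , r≈) → ≤-respʳ (sym r≈) (Box.1≤value b e))

    -- Boxes are unconstrained off the edges, where an infimum need not exist; `0#` is a placeholder
    -- there.
    w : Fin n → Fin n → Carrier
    w x y with x ~? y
    ... | yes e = proj₁ (least-value e)
    ... | no _  = 0#

    w-infimum : ∀ {x y} → x ~ y → IsInfimum _≤_ (FeasibleValue x y) (w x y)
    w-infimum {x} {y} e with x ~? y
    ... | yes e′ = proj₂ (least-value e′)
    ... | no x≁y = ⊥-elim (x≁y e)

    w-sym-≤ : ∀ {x y} → x ~ y → w x y ≤ w y x
    w-sym-≤ e = proj₂ (w-infimum (~-sym e)) _ λ _ (b , feasible , r≈) →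
      proj₁ (w-infimum e) _ (b , feasible , trans r≈ (Box.symmetric b (~-sym e)))

  -- As in the Knaster–Tarski theorem, the infimum of all x with F x ≤ x is a fixed point.
  w★ : Box
  w★ = record
    { value     = w
    ; symmetric = λ e → antisym (w-sym-≤ e) (w-sym-≤ (~-sym e))
    ; 1≤value   = λ e → proj₂ (w-infimum e) 1# λ _ (b , _ , r≈) → ≤-respʳ (sym r≈) (Box.1≤value b e)
    }

  w★-least : ∀ {b} → Feasible b → value w★ ≤ᴱ value b
  w★-least {b} feasible e = proj₁ (w-infimum e) _ (b , feasible , refl)

  -- F w★ ≤ F b ≤ b for every feasible b, and w★ is the greatest lower bound of these b.
  F-w★≤w★ : value (F w★) ≤ᴱ value w★
  F-w★≤w★ e = proj₂ (w-infimum e) _ λ _ (b , feasible , r≈) → ≤-respʳ (sym r≈)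
    (F≤ w★ (Box.1≤value b e) (≤-trans (product-mono-≤ {w★} {b} (w★-least {b} feasible) _ _) (feasible _ _ e)))

  -- For the remaining inequality, F (F w★) ≤ F w★ by monotonicity, so F w★ is feasible and lies
  -- above w★.
  w★-fixed : IsFixedPoint w★
  w★-fixed e = antisym (F-w★≤w★ e) (w★-least {F w★} F-feasible e)
    where
    F-feasible : Feasible (F w★)
    F-feasible _ _ e = ≤-trans (product-mono-≤ {F w★} {w★} F-w★≤w★ _ _) (product≤F² w★ _ _)

  module _ {b} (fixed : IsFixedPoint b) where

    fixed-feasible : Feasible b
    fixed-feasible _ _ e = ≤-respʳ (*-cong (fixed e) (fixed e)) (product≤F² b _ _)

    fixed-cases : ∀ {x y} → x ~ y → value b x y ≈ 1# ⊎ A x y b * A y x b ≈ value b x y * value b x y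
    fixed-cases {x} {y} e with F-cases b x y
    ... | inj₁ eq = inj₁ (trans (sym (fixed e)) eq)
    ... | inj₂ eq = inj₂ (trans (sym eq) (*-cong (fixed e) (fixed e)))

    fixed-pendant : ∀ {x y} → x ~ y → ¬ (∃ λ z → x ~ z × z ≢ y) → value b x y ≈ 1#
    fixed-pendant {x} {y} e none with fixed-cases e
    ... | inj₁ eq = eq
    ... | inj₂ eq = ⊥-elim (0<⇒≉0 (*-positive (value>0 b e) (value>0 b e)) (trans (sym eq) (A-empty b none)))

    -- The cutoff loses nothing on an interior edge: both factors are at least 1, so a value of 1
    -- forces their product to be 1 as well.
    fixed-interior : ∀ {x y z t} → x ~ y → x ~ z → z ≢ y → y ~ t → t ≢ x →
                     A x y b * A y x b ≈ value b x y * value b x y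
    fixed-interior {x} {y} e xz z≢y yt t≢x with fixed-cases e
    ... | inj₂ eq = eq
    ... | inj₁ eq = antisym (fixed-feasible _ _ e) (≤-respˡ (sym (*-cong eq eq))
                      (*-mono-≤ 0≤1 0≤1 (1≤A b xz z≢y) (1≤A b yt t≢x)))

    fixed>1 : ∀ {x y} → x ~ y → 1# < value b x y → A x y b * A y x b ≈ value b x y * value b x y
    fixed>1 e 1<b with fixed-cases e
    ... | inj₁ eq = ⊥-elim (proj₂ 1<b (sym eq))
    ... | inj₂ eq = eq

    fixed>1-continues : ∀ {x y} → x ~ y → 1# < value b x y → ∃ λ z → y ~ z × z ≢ x
    fixed>1-continues {x} {y} e 1<b with other? y x
    ... | yes p = p
    ... | no none = ⊥-elim (proj₂ 1<b (sym (trans (Box.symmetric b e) (fixed-pendant (~-sym e) none))))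

    -- A larger bound would put every edge above 1, so every edge would continue at its far end.
    -- This supplies the infimum 1 that normalization asks for.
    fixed-lowerBound≤1 : ∀ c → LowerBound _≤_ (EdgeValue (value b)) c → c ≤ 1#
    fixed-lowerBound≤1 c c≤ = ≮⇒≥ λ 1<c → no-escape _~_ id
      (λ e → let (z , e′ , z≢) = fixed>1-continues e (<-≤-trans 1<c (c≤ _ (_ , _ , e , refl))) in z , z≢ , e′)
      (proj₂ (proj₂ edge))

  -- If b / c attains its maximum m > 1 at an edge, then it attains it at all edges further out.
  fixed-≤ : ∀ {b c} → IsFixedPoint b → IsFixedPoint c → value b ≤ᴱ value c
  fixed-≤ {b} {c} b-fixed c-fixed {x} {y} e = ≮⇒≥ λ c<b → no-escape (Q c<b) proj₁ (continue c<b)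
    (uv , cancel uv)
    where
    ratio : Fin n → Fin n → Carrier
    ratio x y = value b x y * value c x y ⁻¹
    argmax = edge-maximum edge ratio
    u v : Fin n
    u = proj₁ argmax
    v = proj₁ (proj₂ argmax)
    uv : u ~ v
    uv = proj₁ (proj₂ (proj₂ argmax))
    m : Carrier
    m = ratio u v
    cancel : ∀ {x y} → x ~ y → ratio x y * value c x y ≈ value b x y
    cancel e = trans (*-assoc _ _ _) (trans (*-congˡ (⁻¹-inverseˡ (value>0 c e))) (*-identityʳ _))
    mc : Fin n → Fin n → Carrier
    mc x y = m * value c x y
    b≤mc : value b ≤ᴱ mc
    b≤mc e = ≤-respˡ (cancel e) (*-monoˡ-≤ (value≥0 c e) (proj₂ (proj₂ (proj₂ argmax)) e))
    module _ (c<b : value c x y < value b x y) where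
      1<m : 1# < m
      1<m = ≰⇒> λ m≤1 → <⇒≱ c<b (≤-trans (b≤mc e) (≤-respʳ (*-identityˡ _) (*-monoˡ-≤ (value≥0 c e) m≤1)))
      Q : Fin n → Fin n → Set
      Q x y = x ~ y × mc x y ≈ value b x y
      continue : ∀ {x y} → Q x y → ∃ λ z → z ≢ x × Q y z
      continue {x} {y} (e , mc≈b) = z , z≢x , f , antisym
        (squeeze b≤mc (value≥0 b) (<-≤-trans (*-positive (value>0 b e) (value>0 b e)) (≤-reflexive (sym AA≈bb)))
          AA≤ f z≢x)
        (b≤mc f)
        where
        0≤m : 0# ≤ m
        0≤m = <⇒≤ (≤-<-trans 0≤1 1<m)
        -- Since c ≥ 1, b = m c ≥ m > 1. So the cutoff is inactive for `b` at this edge, and the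
        -- edge continues.
        1<b : 1# < value b x y
        1<b = <-≤-trans 1<m (≤-respˡ (*-identityʳ m) (≤-respʳ mc≈b (*-monoʳ-≤ 0≤m (Box.1≤value c e))))
        AA≈bb : A x y b * A y x b ≈ value b x y * value b x y
        AA≈bb = fixed>1 {b} b-fixed e 1<b
        AA≤ : others x y mc * others y x mc ≤ A x y b * A y x b
        AA≤ = begin
          others x y mc * others y x mc            ≈⟨ others-product-*ˡ m (value c) x y ⟩
          m * m * (A x y c * A y x c)              ≤⟨ *-monoʳ-≤ (*-nonNeg 0≤m 0≤m) (fixed-feasible {c} c-fixed x y e) ⟩
          m * m * (value c x y * value c x y)      ≈⟨ solve 2 (λ m c → m :* m :* (c :* c) := m :* c :* (m :* c)) refl m _ ⟩
          mc x y * mc x y                          ≈⟨ *-cong mc≈b mc≈b ⟩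
          value b x y * value b x y                ≈⟨ AA≈bb ⟨
          A x y b * A y x b                        ∎
          where open ≤R
        beyond = fixed>1-continues {b} b-fixed e 1<b
        z = proj₁ beyond
        f = proj₁ (proj₂ beyond)
        z≢x = proj₂ (proj₂ beyond)

-- Degree one and the absence of other neighbours

module Degrees {n} (G : SimpleGraph n) where
  open SimpleGraph G

  degree≡1⇒ : ∀ {x y z} → degree G x ≡ 1 → x ~ y → x ~ z → z ≡ y
  degree≡1⇒ {x} {y} {z} deg≡1 e f =
    same (filter (x ~?_) (allFin n)) deg≡1 (∈-filter⁺ (x ~?_) (∈-allFin z) f) (∈-filter⁺ (x ~?_) (∈-allFin y) e)
    where
    same : ∀ (xs : List (Fin n)) → length xs ≡ 1 → ∀ {y z} → z ∈ xs → y ∈ xs → z ≡ y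
    same (_ ∷ []) _ (here ≡.refl) (here ≡.refl) = ≡.refl

  degree≡1⇐ : ∀ {x y} → x ~ y → ¬ (∃ λ z → x ~ z × z ≢ y) → degree G x ≡ 1
  degree≡1⇐ {x} {y} e none =
    singleton (filter (x ~?_) (allFin n)) (filter⁺ (x ~?_) (allFin⁺ n))
      (All.map only (all-filter (x ~?_) (allFin n))) (∈-filter⁺ (x ~?_) (∈-allFin y) e)
    where
    only : ∀ {z} → x ~ z → z ≡ y
    only {z} f with z ≟ᶠ y
    ... | yes z≡y = z≡y
    ... | no z≢y  = ⊥-elim (none (z , f , z≢y))
    singleton : ∀ (xs : List (Fin n)) → Unique xs → All.All (_≡ y) xs → y ∈ xs → length xs ≡ 1
    singleton (_ ∷ [])    _              _                      _ = ≡.refl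
    singleton (_ ∷ _ ∷ _) ((a≢b ∷ _) ∷ _) (a≡y ∷ b≡y ∷ _) _ = ⊥-elim (a≢b (≡.trans a≡y (≡.sym b≡y)))

-- Distortion and rigidity of optimal weights

module OptimalWeights (ℝ : CompleteOrderedField) {n} {T : SimpleGraph n} (tree : IsTree T) (edge : HasEdge T) where
  open OrderedField ℝ
  open Sums ℝ
  open OtherEdges ℝ T
  open EdgeLemmas ℝ T
  open SimpleGraph T
  open IsTree tree
  open Curvature ℝ T connected
  open FeasibleBoxes ℝ tree edge using (Feasible)
  open FixedPoints ℝ tree edge
  open Degrees T
  open AdmissibleWeights ℝ tree

  private
    W★ : Fin n → Fin n → Carrier
    W★ = value w★

    product★≤ : Feasible w★
    product★≤ = fixed-feasible {w★} w★-fixed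

    peak = edge-maximum edge W★

  a b : Fin n
  a = proj₁ peak
  b = proj₁ (proj₂ peak)

  ab : a ~ b
  ab = proj₁ (proj₂ (proj₂ peak))

  m : Carrier
  m = W★ a b

  W★≤m : ∀ {x y} → x ~ y → W★ x y ≤ m
  W★≤m = proj₂ (proj₂ (proj₂ peak))

  m-isMaximum : IsMaximum _≤_ (EdgeValue W★) m
  m-isMaximum = (a , b , ab , refl) , λ _ (_ , _ , e , r≈) → ≤-respˡ (sym r≈) (W★≤m e)

  inf★≈1 : IsInfimum _≤_ (EdgeValue W★) 1#
  inf★≈1 = (λ _ (_ , _ , e , r≈) → ≤-respʳ (sym r≈) (Box.1≤value w★ e)) , fixed-lowerBound≤1 {w★} w★-fixed

  w★-admissible : Admissible (toWeight w★)
  w★-admissible = product≤⇒admissible (toWeight w★) (product★≤ _ _)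

  x≈x/1 : ∀ x → x ≈ x / 1#
  x≈x/1 x = trans (sym (*-identityʳ x)) (*-congˡ (trans (sym (⁻¹-inverseʳ 0<1)) (*-identityˡ _)))

  dist★ : IsDist (toWeight w★) [ m ]
  dist★ = finite (proj₂ m-isMaximum , λ c ≤c → ≤c m (proj₁ m-isMaximum)) inf★≈1 0<1 (x≈x/1 m)

  w★-normalized : Normalized (toWeight w★)
  w★-normalized = (m , dist★) , inf★≈1

  -- Dividing by i moves `w` into the box and keeps it feasible by homogeneity, so it dominates w★.
  -- The case i = 1 is minimality; the value at the peak edge bounds the distortion.
  scaled-minimal : ∀ {w} → Admissible w → ∀ {i} → 0# < i → LowerBound _≤_ (EdgeValue ⟦ w ⟧) i →
                   ∀ {x y} → x ~ y → i * W★ x y ≤ ⟦ w ⟧ x y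
  scaled-minimal {w} admissible {i} 0<i i≤ {x} {y} e = ≤-respʳ (cancel x y)
    (*-monoʳ-≤ (<⇒≤ 0<i) (w★-least {z} feasible e))
    where
    cancel : ∀ x y → i * (i ⁻¹ * ⟦ w ⟧ x y) ≈ ⟦ w ⟧ x y
    cancel x y = trans (sym (*-assoc _ _ _)) (trans (*-congʳ (⁻¹-inverseʳ 0<i)) (*-identityˡ _))
    0≤i⁻¹ : 0# ≤ i ⁻¹
    0≤i⁻¹ = <⇒≤ (⁻¹-positive 0<i)
    z : Box
    z = record
      { value     = λ x y → i ⁻¹ * ⟦ w ⟧ x y
      ; symmetric = λ e → *-congˡ (Weight.symmetric w e)
      ; 1≤value   = λ e → ≤-respˡ (⁻¹-inverseˡ 0<i) (*-monoʳ-≤ 0≤i⁻¹ (i≤ _ (_ , _ , e , refl)))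
      }
    feasible : Feasible z
    feasible x y e = ≤-respˡ (sym (others-product-*ˡ (i ⁻¹) ⟦ w ⟧ x y))
      (≤-respʳ (solve 2 (λ i v → i :* i :* (v :* v) := i :* v :* (i :* v)) refl _ _)
        (*-monoʳ-≤ (*-nonNeg 0≤i⁻¹ 0≤i⁻¹) (admissible⇒product≤ w admissible e)))

  w★-minimal : ∀ z → Normalized z → Admissible z → W★ ≤ᴱ ⟦ z ⟧
  w★-minimal z (_ , (1≤z , _)) admissible e =
    ≤-respˡ (*-identityˡ _) (scaled-minimal {z} admissible 0<1 1≤z e)

  ⊤≰m : ¬ ⊤⁺ ≤⁺ [ m ]
  ⊤≰m ()

  m-isDN : IsDN [ m ]
  m-isDN = lower , λ D D≤ → D≤ [ m ] (toWeight w★ , w★-admissible , dist★)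
    where
    lower : ∀ D → (∃ λ w → Admissible w × IsDist w D) → [ m ] ≤⁺ D
    -- At the peak edge, i m ≤ w_ab ≤ M = i D, and i cancels.
    lower _ (w , admissible , finite {M} {i} {D} (≤M , _) (i≤ , _) 0<i D≈) = [ *-cancelˡ-≤ 0<i
      (≤-trans (scaled-minimal {w} admissible 0<i i≤ ab) (≤-respʳ (sym (x≈y/c⇒cx≈y 0<i D≈)) (≤M _ (_ , _ , ab , refl)))) ]
    lower _ (_ , _ , sup-infinite _) = _ ≤⊤⁺
    lower _ (_ , _ , inf-zero _)     = _ ≤⊤⁺

  w★-optimal : Optimal (toWeight w★)
  w★-optimal = w★-admissible , [ m ] , dist★ , m-isDN

  w★-flat : ∀ {x y} → x ~ y → ¬ Pendant T x y → IsκLLY (toWeight w★) x y 0#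
  w★-flat {x} {y} e ¬pendant with other? x y | other? y x
  ... | yes (_ , xz , z≢y) | yes (_ , yt , t≢x) =
    product≈⇒flat (toWeight w★) e (fixed-interior {w★} w★-fixed e xz z≢y yt t≢x)
  ... | no none | _       = ⊥-elim (¬pendant (inj₁ (degree≡1⇐ e none)))
  ... | yes _   | no none = ⊥-elim (¬pendant (inj₂ (degree≡1⇐ (~-sym e) none)))

  w★-pendant : ∀ {x y} → x ~ y → Pendant T x y → W★ x y ≈ 1#
  w★-pendant e (inj₁ deg≡1) = fixed-pendant {w★} w★-fixed e λ (_ , f , z≢y) → z≢y (degree≡1⇒ deg≡1 e f)
  w★-pendant e (inj₂ deg≡1) = trans (Box.symmetric w★ e)
    (fixed-pendant {w★} w★-fixed (~-sym e) λ (_ , f , z≢x) → z≢x (degree≡1⇒ deg≡1 (~-sym e) f))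

  -- An admissible weight above i w★ with the same maximum agrees with i w★: the
  -- agreement at a maximal edge propagates, since interior edges are flat for w★.
  module Rigidity (w : Weight) (admissible : Admissible w) {i : Carrier} (0<i : 0# < i)
                  (i≤ : LowerBound _≤_ (EdgeValue ⟦ w ⟧) i)
                  (w≤ : ∀ {x y} → x ~ y → ⟦ w ⟧ x y ≤ i * m) where

    iW★ : Fin n → Fin n → Carrier
    iW★ x y = i * W★ x y

    Good : Fin n → Set
    Good x = ∀ {y} → x ~ y → ⟦ w ⟧ x y ≤ iW★ x y

    flip : ∀ {x y} → x ~ y → ⟦ w ⟧ x y ≤ iW★ x y → ⟦ w ⟧ y x ≤ iW★ y x
    flip e = ≤-respˡ (Weight.symmetric w e) ∘ ≤-respʳ (*-congˡ (Box.symmetric w★ e))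

    -- The neighbours `z` and `t` make the edge interior, hence flat for w★. Admissibility bounds
    -- the product for `w` by w_xy² ≤ (i w★_xy)², which is the product for i w★; `squeeze` then
    -- gives equality beyond `y`.
    spread : ∀ {x y z t} → x ~ y → x ~ z → z ≢ y → y ~ t → t ≢ x → ⟦ w ⟧ x y ≤ iW★ x y → Good y
    spread {x} {y} e xz z≢y yt t≢x wxy≤ {u} yu with u ≟ᶠ x
    ... | yes ≡.refl = flip e wxy≤
    ... | no u≢x = squeeze (scaled-minimal {w} admissible 0<i i≤) (λ f → <⇒≤ (iW★-positive f))
          (<-≤-trans (*-positive (iW★-positive e) (iW★-positive e)) (≤-reflexive (sym product≈)))
          (≤-trans (admissible⇒product≤ w admissible e)
            (≤-respʳ (sym product≈) (square-mono-≤ (<⇒≤ (Weight.positive w e)) wxy≤)))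
          yu u≢x
      where
      iW★-positive : ∀ {x y} → x ~ y → 0# < iW★ x y
      iW★-positive f = *-positive 0<i (value>0 w★ f)
      product≈ : others x y iW★ * others y x iW★ ≈ iW★ x y * iW★ x y
      product≈ = trans (others-product-*ˡ i W★ x y)
        (trans (*-congˡ (fixed-interior {w★} w★-fixed e xz z≢y yt t≢x))
          (solve 2 (λ i v → i :* i :* (v :* v) := i :* v :* (i :* v)) refl _ _))

    -- Two consecutive good vertices are carried along because `x` certifies that `y` has a
    -- neighbour other than `z`, while the edge to be treated certifies the same at `z`.
    good-step : ∀ {x y z} → x ~ y → y ~ z → Good x → Good y → Good z
    good-step {x} {y} {z} xy yz good-x good-y {u} zu with z ≟ᶠ x | u ≟ᶠ y
    ... | yes ≡.refl | _          = good-x zu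
    ... | no _       | yes ≡.refl = flip yz (good-y yz)
    ... | no z≢x     | no u≢y     = spread yz (~-sym xy) (z≢x ∘ ≡.sym) zu u≢y (good-y yz) zu

    good-walk : ∀ {x y z k} → x ~ y → Good x → Good y → Walk T y z k → Good z
    good-walk e good-x good-y stop       = good-y
    good-walk e good-x good-y (step f p) = good-walk f good-y (good-step e f good-x good-y) p

    good-if-flat : m ≈ 1# → ∀ x → Good x
    good-if-flat m≈1 x e = ≤-trans (w≤ e) (*-monoʳ-≤ (<⇒≤ 0<i) (≤-respˡ (sym m≈1) (Box.1≤value w★ e)))

    good : ∀ x → Good x
    good x with other? a b | other? b a
    -- A pendant peak edge means m = 1, so `w` is squeezed between i and i on all edges.
    ... | no none | _       = good-if-flat (fixed-pendant {w★} w★-fixed ab none) x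
    ... | yes _   | no none =
      good-if-flat (trans (Box.symmetric w★ ab) (fixed-pendant {w★} w★-fixed (~-sym ab) none)) x
    ... | yes (_ , az , z≢b) | yes (_ , bt , t≢a) = good-walk ab
      (spread (~-sym ab) bt t≢a az z≢b (flip ab (w≤ ab)))
      (spread ab az z≢b bt t≢a (w≤ ab)) (proj₂ (connected b x))

    proportional : ⟦ w ⟧ ≈ᴱ iW★
    proportional e = antisym (good _ e) (scaled-minimal {w} admissible 0<i i≤ e)

  Proportional : Weight → Set
  Proportional w = ∃ λ i → 0# < i × IsInfimum _≤_ (EdgeValue ⟦ w ⟧) i × ⟦ w ⟧ ≈ᴱ (λ x y → i * W★ x y)

  -- The chain w ≤ M = i D ≤ i m is the upper bound that `Rigidity` requires.
  proportional-if-D≤m : ∀ w → Admissible w → ∀ {D M i} → IsSupremum _≤_ (EdgeValue ⟦ w ⟧) M →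
    IsInfimum _≤_ (EdgeValue ⟦ w ⟧) i → 0# < i → D ≈ M / i → D ≤ m → Proportional w
  proportional-if-D≤m w admissible {i = i} (≤M , _) inf 0<i D≈ D≤m =
    i , 0<i , inf , Rigidity.proportional w admissible 0<i (proj₁ inf) λ e →
      ≤-trans (≤M _ (_ , _ , e , refl)) (≤-respˡ (x≈y/c⇒cx≈y 0<i D≈) (*-monoʳ-≤ (<⇒≤ 0<i) D≤m))

  optimal⇒proportional : ∀ w → Optimal w → Proportional w
  optimal⇒proportional w (admissible , _ , finite sup inf 0<i D≈ , D≤ , _) =
    proportional-if-D≤m w admissible sup inf 0<i D≈ ([≤]-injective _ (D≤ [ m ] (toWeight w★ , w★-admissible , dist★)))
  optimal⇒proportional w (_ , _ , sup-infinite _ , ⊤≤ , _) =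
    ⊥-elim (⊤≰m (⊤≤ [ m ] (toWeight w★ , w★-admissible , dist★)))
  optimal⇒proportional w (_ , _ , inf-zero _ , ⊤≤ , _) =
    ⊥-elim (⊤≰m (⊤≤ [ m ] (toWeight w★ , w★-admissible , dist★)))

  normalized-optimal-unique : ∀ z → Normalized z → Optimal z → ⟦ z ⟧ ≈ᴱ W★
  normalized-optimal-unique z (_ , inf₁) optimal with optimal⇒proportional z optimal
  ... | i , _ , inf , z≈ = λ e → trans (z≈ e) (trans (*-congʳ (infimum-unique inf inf₁)) (*-identityˡ _))

  optimal-unique : ∀ v w → Optimal v → Optimal w → ∃ λ c → 0# < c × ⟦ w ⟧ ≈ᴱ (λ x y → c * ⟦ v ⟧ x y)
  optimal-unique v w v-optimal w-optimal with optimal⇒proportional v v-optimal | optimal⇒proportional w w-optimal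
  ... | i , 0<i , _ , v≈ | j , 0<j , _ , w≈ = j * i ⁻¹ , *-positive 0<j (⁻¹-positive 0<i) , λ e →
    trans (w≈ e) (trans (*-congˡ (sym (trans (*-congˡ (v≈ e)) (⁻¹-cancelˡ _ 0<i)))) (sym (*-assoc _ _ _)))

theorem1p3 :
  (ℝ : CompleteOrderedField) {n : ℕ} (T : SimpleGraph n) (tree : IsTree T) → HasEdge T →
  let open CompleteOrderedField ℝ
      open SimpleGraph T
      open Curvature ℝ T (IsTree.connected tree)
  in
  ∃ λ (w★ : Box) →
    -- (a)
    (IsFixedPoint w★ × (∀ x → IsFixedPoint x → value x ≈ᴱ value w★)) ×
    -- (b)
    (∃ λ m → IsMaximum _≤_ (EdgeValue (value w★)) m × IsDN [ m ]) ×
    -- (c)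
    ((Normalized (toWeight w★) × Admissible (toWeight w★) ×
      (∀ z → Normalized z → Admissible z → value w★ ≤ᴱ ⟦ z ⟧)) ×
     (Optimal (toWeight w★) ×
      (∀ z → Normalized z → Optimal z → ⟦ z ⟧ ≈ᴱ value w★)) ×
     (∀ v w → Optimal v → Optimal w →
      ∃ λ c → 0# < c × ⟦ w ⟧ ≈ᴱ (λ x y → c * ⟦ v ⟧ x y))) ×
    -- (d)
    (∀ {x y} → x ~ y →
      (Pendant T x y → value w★ x y ≈ 1#) ×
      (¬ Pendant T x y → IsκLLY (toWeight w★) x y 0#))
theorem1p3 ℝ T tree edge =
  w★ ,
  ((λ {_} → w★-fixed) , λ x x-fixed e → antisym (fixed-≤ {x} {w★} x-fixed w★-fixed e) (fixed-≤ {w★} {x} w★-fixed x-fixed e)) ,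
  (m , m-isMaximum , m-isDN) ,
  ((w★-normalized , w★-admissible , w★-minimal) ,
   (w★-optimal , normalized-optimal-unique) ,
   optimal-unique) ,
  λ e → w★-pendant e , w★-flat e
  where
  open CompleteOrderedField ℝ using (antisym)
  open FixedPoints ℝ tree edge
  open OptimalWeights ℝ tree edge
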